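{- Let $M$ be a mixed graph of order $n$ with vertex set $\{v_1,\dots,v_n\}$ and Hermitian-Randić matrix $R_H(M)$. Then $$\det R_H(M)=\sum_{M'}(-1)^{r(M')+l(M')}\,2^{s(M')}\,W(M'),$$ where the summation is over all real spanning elementary subgraphs $M'$ of $M$, $r(M')=n-c(M')$ with $c(M')$ the number of components of $M'$, $l(M')$ is the number of negative mixed cycles of $M'$, $s(M')$ is the number of mixed cycles of length $\ge 3$ in $M'$, and $W(M')=\prod_{v_i\in V(M')}\frac{1}{d_{M_U}(v_i)}$.
   Context: A mixed graph $M$ is obtained from a simple undirected graph $M_U$ (its underlying graph) by orienting a subset of its edges; thus each edge of $M_U$ is either an undirected edge $v_kv_l$ or an arc $(v_k,v_l)$ of $M$. The degree $d_k=d(v_k)$ of $v_k$ is its degree in $M_U$. The Hermitian-Randić matrix $R_H(M)=((r_h)_{kl})$ is the $n\times n$ matrix with $(r_h)_{kl}=(r_h)_{lk}=\frac{1}{\sqrt{d_kd_l}}$ if $v_kv_l$ is an undirected edge, $(r_h)_{kl}=-(r_h)_{lk}=\frac{\mathrm{i}}{\sqrt{d_kd_l}}$ ($\mathrm{i}=\sqrt{ -1}$) if $(v_k,v_l)$ is an arc, and $(r_h)_{kl}=0$ otherwise. For a mixed cycle $C=v_1v_2\cdots v_lv_1$ (a cycle of $M_U$ of length $\ge 3$ traversed in a direction), its value is $(r_h)_{12}(r_h)_{23}\cdots(r_h)_{l1}$, which equals $\epsilon\prod_{v_j\in V(C)}\frac{1}{d(v_j)}$ with $\epsilon\in\{1,-1,\mathrm{i},-\mathrm{i}\}$;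 reversing direction conjugates the value. The cycle is real if its value is real, positive if its value is $\prod_{v_j\in V(C)}\frac{1}{d(v_j)}$ and negative if its value is $-\prod_{v_j\in V(C)}\frac{1}{d(v_j)}$. An elementary graph is a mixed graph each of whose components is an (undirected) edge, an arc, or a mixed cycle; edge- and arc-components are not counted as cycles. A real spanning elementary subgraph of $M$ is a subgraph that is elementary, contains all vertices of $M$, and all of whose mixed cycles are real. -}

module Defs where

open import Level using (Level)
open import Data.Bool using (T?; Bool; true; false; _∧_; _∨_; not; if_then_else_)
open import Data.Nat using (ℕ; zero; suc; _%_; _≡ᵇ_) renaming (_+_ to _+ℕ_)
open import Data.Nat.Base using (_≤ᵇ_)
open import Data.Fin using (Fin; zero; suc; toℕ; punchIn)
import Data.Fin as F
open import Data.Vec using (Vec; []; _∷_; lookup)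
open import Data.List using (List; []; _∷_; map; concatMap; filter; foldr)
open import Data.Maybe using (Maybe; just; nothing)
open import Relation.Nullary.Decidable using (⌊_⌋)
open import Relation.Binary.PropositionalEquality using (_≡_)
open import Algebra.Bundles using (CommutativeRing)

-- Mixed graphs on the vertex set Fin n  (vertex k ↔ v_{k+1})

-- The relation between an ordered pair (v_k , v_l):
--   none  : not adjacent
--   undir : undirected edge v_k v_l
--   out   : arc (v_k , v_l)
--   inn   : arc (v_l , v_k)
data Kind : Set where
  none undir out inn : Kind

flipK : Kind → Kind
flipK none  = none
flipK undir = undir
flipK out   = inn
flipK inn   = out

isEdge : Kind → Bool
isEdge none = false
isEdge _    = true

record MixedGraph (n : ℕ) : Set where
  field
    kind   : Fin n → Fin n → Kind
    irrefl : ∀ k → kind k k ≡ none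
    skew   : ∀ k l → kind l k ≡ flipK (kind k l)
open MixedGraph public

_==F_ : ∀ {n} → Fin n → Fin n → Bool
i ==F j = ⌊ i F.≟ j ⌋

countF : ∀ {n} → (Fin n → Bool) → ℕ
countF {zero}  p = 0
countF {suc n} p = (if p zero then 1 else 0) +ℕ countF (λ i → p (suc i))

anyF : ∀ {n} → (Fin n → Bool) → Bool
anyF {zero}  p = false
anyF {suc n} p = p zero ∨ anyF (λ i → p (suc i))

allF : ∀ {n} → (Fin n → Bool) → Bool
allF p = not (anyF (λ i → not (p i)))

findF : ∀ {n} → (Fin n → Bool) → Maybe (Fin n)
findF {zero}  p = nothing
findF {suc n} p with p zero
... | true  = just zero
... | false with findF (λ i → p (suc i))
...   | just i  = just (suc i)
...   | nothing = nothing

deg : ∀ {n} → MixedGraph n → Fin n → ℕ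
deg M k = countF (λ l → isEdge (kind M k l))

-- Spanning subgraphs of M, given by their (undirected) edge set as a
-- boolean adjacency matrix; orientations are inherited from M.

ESet : ℕ → Set
ESet n = Vec (Vec Bool n) n

adjE : ∀ {n} → ESet n → Fin n → Fin n → Bool
adjE E k l = lookup (lookup E k) l

allBoolVec : (m : ℕ) → List (Vec Bool m)
allBoolVec zero    = [] ∷ []
allBoolVec (suc m) = concatMap (λ v → (false ∷ v) ∷ (true ∷ v) ∷ []) (allBoolVec m)

allVecOf : ∀ {A : Set} → List A → (m : ℕ) → List (Vec A m)
allVecOf xs zero    = [] ∷ []
allVecOf xs (suc m) = concatMap (λ v → map (λ x → x ∷ v) xs) (allVecOf xs m)

allESet : (n : ℕ) → List (ESet n)
allESet n = allVecOf (allBoolVec n) n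

isSubgraph : ∀ {n} → MixedGraph n → ESet n → Bool
isSubgraph M E =
  allF (λ k → allF (λ l →
    (not (adjE E k l) ∨ isEdge (kind M k l)) ∧ (adjE E k l ==B adjE E l k)))
  where
  _==B_ : Bool → Bool → Bool
  true  ==B b = b
  false ==B b = not b

degE : ∀ {n} → ESet n → Fin n → ℕ
degE E k = countF (λ l → adjE E k l)

reachW : ∀ {n} → ESet n → ℕ → Fin n → Fin n → Bool
reachW E zero    k l = k ==F l
reachW E (suc m) k l = reachW E m k l ∨ anyF (λ j → reachW E m k j ∧ adjE E j l)

-- same connected component of E (walks of length ≤ n suffice)
reach : ∀ {n} → ESet n → Fin n → Fin n → Bool
reach {n} E = reachW E n

-- E (as a spanning subgraph) is elementary: every component is a single
-- edge (connected, all degrees 1 = K₂) or a cycle (connected, all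
-- degrees 2); in particular no isolated vertices.
isElementary : ∀ {n} → ESet n → Bool
isElementary E =
  allF (λ k → ((degE E k ≡ᵇ 1) ∨ (degE E k ≡ᵇ 2)) ∧
              allF (λ l → not (reach E k l) ∨ (degE E k ≡ᵇ degE E l)))

isRep : ∀ {n} → ESet n → Fin n → Bool
isRep E k = allF (λ l → not (reach E k l) ∨ (toℕ k ≤ᵇ toℕ l))

isCycleRep : ∀ {n} → ESet n → Fin n → Bool
isCycleRep E k = isRep E k ∧ (degE E k ≡ᵇ 2)

-- Value of a mixed cycle.  Traversing v_k → v_l contributes the factor
-- 1 (undirected edge), i (arc (v_k,v_l)) or -i (arc (v_l,v_k)) times
-- 1/√(d_k d_l); so the value is ε ∏ 1/d with ε = i^p, p the "phase":
phase : Kind → ℕ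
phase none  = 0
phase undir = 0
phase out   = 1
phase inn   = 3

walkPhase : ∀ {n} → MixedGraph n → ESet n → ℕ → Fin n → Fin n → Fin n → ℕ
walkPhase M E zero    s prev cur = 0
walkPhase M E (suc f) s prev cur with findF (λ x → adjE E cur x ∧ not (x ==F prev))
... | nothing = 0
... | just x  = phase (kind M cur x) +ℕ
                (if x ==F s then 0 else walkPhase M E f s cur x)

cyclePhase : ∀ {n} → MixedGraph n → ESet n → Fin n → ℕ
cyclePhase {n} M E k with findF (λ x → adjE E k x)
... | nothing = 0
... | just j  = (phase (kind M k j) +ℕ walkPhase M E n k k j) % 4

-- ε = i^p is real iff p ≡ 0,2 (mod 4); negative iff p ≡ 2 (mod 4)
isRealCycle : ∀ {n} → MixedGraph n → ESet n → Fin n → Bool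
isRealCycle M E k = (cyclePhase M E k ≡ᵇ 0) ∨ (cyclePhase M E k ≡ᵇ 2)

isNegCycle : ∀ {n} → MixedGraph n → ESet n → Fin n → Bool
isNegCycle M E k = cyclePhase M E k ≡ᵇ 2

isRSES : ∀ {n} → MixedGraph n → ESet n → Bool
isRSES M E = isSubgraph M E ∧ isElementary E ∧
             allF (λ k → not (isCycleRep E k) ∨ isRealCycle M E k)

cComp : ∀ {n} → ESet n → ℕ
cComp E = countF (isRep E)

sCyc : ∀ {n} → ESet n → ℕ
sCyc E = countF (isCycleRep E)

lNeg : ∀ {n} → MixedGraph n → ESet n → ℕ
lNeg M E = countF (λ k → isCycleRep E k ∧ isNegCycle M E k)

RSESs : ∀ {n} → MixedGraph n → List (ESet n)
RSESs {n} M = filter (λ E → T? (isRSES M E)) (allESet n)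


module RingDefs {c ℓ : Level} (R : CommutativeRing c ℓ) where
  open CommutativeRing R using (Carrier; _≈_; _+_; _*_; -_; 0#; 1#)

  fromℕ : ℕ → Carrier
  fromℕ zero    = 0#
  fromℕ (suc m) = 1# + fromℕ m

  sumF : ∀ {n} → (Fin n → Carrier) → Carrier
  sumF {zero}  f = 0#
  sumF {suc n} f = f zero + sumF (λ i → f (suc i))

  prodF : ∀ {n} → (Fin n → Carrier) → Carrier
  prodF {zero}  f = 1#
  prodF {suc n} f = f zero * prodF (λ i → f (suc i))

  sgn : ℕ → Carrier
  sgn zero    = 1#
  sgn (suc m) = - (sgn m)

  det : ∀ {n} → (Fin n → Fin n → Carrier) → Carrier
  det {zero}  A = 1#
  det {suc n} A =
    sumF (λ j → sgn (toℕ j) * (A zero j * det (λ r s → A (suc r) (punchIn j s))))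

  kindVal : Carrier → Kind → Carrier
  kindVal ι none  = 0#
  kindVal ι undir = 1#
  kindVal ι out   = ι
  kindVal ι inn   = - ι

  -- Hermitian–Randić matrix, with ι playing i and w k playing 1/√d_k
  RH : ∀ {n} → MixedGraph n → Carrier → (Fin n → Carrier) → Fin n → Fin n → Carrier
  RH M ι w k l = kindVal ι (kind M k l) * (w k * w l)

  sumL : List Carrier → Carrier
  sumL = foldr _+_ 0#

module Submission where

open import Defs
open import Level using (Level; _⊔_)
open import Algebra.Bundles using (CommutativeRing)
import Algebra.Properties.CommutativeMonoid.Sum as MonoidSum
import Algebra.Properties.Ring as RingProperties
import Algebra.Solver.Ring.NaturalCoefficients.Default as SemiringSolver
open import Data.Bool using (Bool; true; false; _∧_; _∨_; not; if_then_else_; T)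
import Data.Bool
open import Data.Bool.Properties using (not-injective; not-involutive; ¬-not; not-¬)
open import Data.Fin as Fin using (Fin; zero; suc; toℕ; punchIn; punchOut)
open import Data.Fin.Permutation using (permutation)
import Data.Fin.Properties as Finₚ
open import Data.List as List using (List; []; _∷_; map; concatMap; filter; _++_; allFin)
import Data.List.Properties as Listₚ
open import Data.Maybe using (just; nothing)
open import Data.Nat as ℕ using (ℕ; zero; suc; z≤n; s≤s)
open import Data.Nat.DivMod using (m≡m%n+[m/n]*n; m%n<n)
import Data.Nat.Properties as ℕₚ
open import Data.Product using (∃; _×_; _,_; proj₁; proj₂)
open import Data.Product.Properties using (,-injectiveˡ; ,-injectiveʳ)
open import Data.Sum using (_⊎_; inj₁; inj₂; [_,_]′)
open import Data.Vec using (Vec; []; _∷_; lookup; tabulate)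
import Data.Vec.Properties as Vecₚ
open import Function using (_∘_; id)
open import Relation.Binary.Construct.Closure.ReflexiveTransitive using (Star; ε; _◅_; _◅◅_; reverse)
open import Relation.Binary.PropositionalEquality as ≡ using (_≡_; _≢_; refl; cong; cong₂; subst; _≗_)
import Relation.Binary.Reasoning.Setoid as SetoidReasoning
open import Relation.Nullary using (¬_; Dec; yes; no; contradiction)
open import Relation.Nullary.Decidable using (⌊_⌋)

-- Expand det R_H(M) over permutations σ. A term vanishes unless every v → σ v is an edge, and
-- then the cycles of σ, read as 2-cycles and oriented cycles, form a spanning elementary
-- subgraph E. Conversely the permutations with support E are obtained from one of them by
-- reversing cycles independently; all have sign (-1)^(n - c(E)), so their terms add up to a
-- product over the cycles C of E of val(C) + conj(val(C)), which is ±2 for a real cycle and 0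
-- otherwise. The factors 1/√d(v) occur twice in every term.

-- For the converse, a cyclic orientation must be extracted from a bare edge set known only through
-- its degrees. It comes from colouring edge ends. Pairing the two ends at each vertex, and the two
-- ends of each edge, gives two perfect matchings; their union has only even cycles, so some
-- 2-colouring separates both kinds of pairs, and leaving each vertex by its end coloured `true` is
-- a permutation.
--
-- The sign of a permutation is not introduced as a separate notion. The expansion of `det` yields
-- the determinant of a permutation matrix as the coefficient, and this is evaluated by induction,
-- cutting vertex 0 out of its cycle. Since the shortened permutation no longer comes with an edge
-- set, its cycles are described there only by a function that chooses representatives; the instance
-- needed at the end is `rep E`.
--
-- A general commutative ring has no complex conjugation. The reversed cycle enters through the fact
-- that its unit factor is inverse to the original one, and the inverse of ι^p is ι^(3p) because ι^4
-- = 1.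

∧-true⁻ : ∀ {a b} → a ∧ b ≡ true → a ≡ true × b ≡ true
∧-true⁻ {true} {true} _ = refl , refl

∧-true⁺ : ∀ {a b} → a ≡ true → b ≡ true → a ∧ b ≡ true
∧-true⁺ refl refl = refl

∨-true⁻ : ∀ {a b} → a ∨ b ≡ true → a ≡ true ⊎ b ≡ true
∨-true⁻ {true}  _ = inj₁ refl
∨-true⁻ {false} e = inj₂ e

∨-true⁺ˡ : ∀ {a b} → a ≡ true → a ∨ b ≡ true
∨-true⁺ˡ refl = refl

∨-true⁺ʳ : ∀ {a b} → b ≡ true → a ∨ b ≡ true
∨-true⁺ʳ {true}  _ = refl
∨-true⁺ʳ {false} e = e

not-true⁻ : ∀ {a} → not a ≡ true → a ≡ false
not-true⁻ {false} _ = refl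

not-true⁺ : ∀ {a} → a ≡ false → not a ≡ true
not-true⁺ refl = refl

⇒-true⁻ : ∀ {a b} → not a ∨ b ≡ true → a ≡ true → b ≡ true
⇒-true⁻ e refl = e

⇒-true⁺ : ∀ {a b} → (a ≡ true → b ≡ true) → not a ∨ b ≡ true
⇒-true⁺ {true}  f = f refl
⇒-true⁺ {false} f = refl

true≢false : true ≢ false
true≢false ()

⇔⇒≡ : ∀ {a b} → (a ≡ true → b ≡ true) → (b ≡ true → a ≡ true) → a ≡ b
⇔⇒≡ {true}  {b}     f g = ≡.sym (f refl)
⇔⇒≡ {false} {true}  f g = g refl
⇔⇒≡ {false} {false} f g = refl

bool-split : ∀ b → b ≡ true ⊎ b ≡ false
bool-split true  = inj₁ refl
bool-split false = inj₂ refl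

⌊⌋-true⁻ : ∀ {p} {P : Set p} {d : Dec P} → ⌊ d ⌋ ≡ true → P
⌊⌋-true⁻ {d = yes p} _ = p

⌊⌋-true⁺ : ∀ {p} {P : Set p} {d : Dec P} → P → ⌊ d ⌋ ≡ true
⌊⌋-true⁺ {d = yes _} _ = refl
⌊⌋-true⁺ {d = no ¬p} p = contradiction p ¬p

⌊⌋-false⁺ : ∀ {p} {P : Set p} {d : Dec P} → ¬ P → ⌊ d ⌋ ≡ false
⌊⌋-false⁺ {d = yes p} ¬p = contradiction p ¬p
⌊⌋-false⁺ {d = no _}  _  = refl

==F⇒≡ : ∀ {n} {i j : Fin n} → (i ==F j) ≡ true → i ≡ j
==F⇒≡ = ⌊⌋-true⁻

≡⇒==F : ∀ {n} {i j : Fin n} → i ≡ j → (i ==F j) ≡ true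
≡⇒==F = ⌊⌋-true⁺

≢⇒==F : ∀ {n} {i j : Fin n} → i ≢ j → (i ==F j) ≡ false
≢⇒==F = ⌊⌋-false⁺

==F-false⇒≢ : ∀ {n} {i j : Fin n} → (i ==F j) ≡ false → i ≢ j
==F-false⇒≢ e i≡j = true≢false (≡.trans (≡.sym (≡⇒==F i≡j)) e)

==F-suc : ∀ {n} (i j : Fin n) → (suc i ==F suc j) ≡ (i ==F j)
==F-suc i j = ⇔⇒≡ (≡⇒==F ∘ Finₚ.suc-injective ∘ ==F⇒≡) (≡⇒==F ∘ cong suc ∘ ==F⇒≡)

≡ᵇ-true⁻ : ∀ {m n} → (m ℕ.≡ᵇ n) ≡ true → m ≡ n
≡ᵇ-true⁻ {m} {n} e = ℕₚ.≡ᵇ⇒≡ m n (subst T (≡.sym e) _)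

≡ᵇ-true⁺ : ∀ {m n} → m ≡ n → (m ℕ.≡ᵇ n) ≡ true
≡ᵇ-true⁺ {zero}  refl = refl
≡ᵇ-true⁺ {suc m} refl = ≡ᵇ-true⁺ {m} refl

≤ᵇ-true⁻ : ∀ {m n} → (m ℕ.≤ᵇ n) ≡ true → m ℕ.≤ n
≤ᵇ-true⁻ {m} {n} e = ℕₚ.≤ᵇ⇒≤ m n (subst T (≡.sym e) _)

≤ᵇ-true⁺ : ∀ {m n} → m ℕ.≤ n → (m ℕ.≤ᵇ n) ≡ true
≤ᵇ-true⁺ {m} {n} m≤n with m ℕ.≤ᵇ n | ℕₚ.≤⇒≤ᵇ m≤n
... | true | _ = refl

-- Search and counting over finite sets

anyF⁻ : ∀ {n} {p : Fin n → Bool} → anyF p ≡ true → ∃ λ i → p i ≡ true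
anyF⁻ {suc n} {p} e with p zero in q
... | true  = zero , q
... | false with i , r ← anyF⁻ {n} e = suc i , r

anyF⁺ : ∀ {n} {p : Fin n → Bool} i → p i ≡ true → anyF p ≡ true
anyF⁺ zero    e = ∨-true⁺ˡ e
anyF⁺ (suc i) e = ∨-true⁺ʳ (anyF⁺ i e)

allF⁻ : ∀ {n} {p : Fin n → Bool} → allF p ≡ true → ∀ i → p i ≡ true
allF⁻ {p = p} e i with p i in q
... | true  = refl
... | false = contradiction (≡.trans (≡.sym (anyF⁺ i (not-true⁺ q))) (not-true⁻ e)) true≢false

allF⁺ : ∀ {n} {p : Fin n → Bool} → (∀ i → p i ≡ true) → allF p ≡ true
allF⁺ {p = p} f = not-true⁺ (¬-not λ e →
  let i , q = anyF⁻ e in true≢false (≡.trans (≡.sym (f i)) (not-true⁻ q)))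

allF-false⁻ : ∀ {n} {p : Fin n → Bool} → allF p ≡ false → ∃ λ i → p i ≡ false
allF-false⁻ e with i , q ← anyF⁻ (not-injective {y = true} e) = i , not-true⁻ q

findF-just : ∀ {n} {p : Fin n → Bool} {x} → findF p ≡ just x →
             p x ≡ true × (∀ y → p y ≡ true → toℕ x ℕ.≤ toℕ y)
findF-just {suc n} {p} e with p zero in q
findF-just {suc n} {p} refl | true = q , λ _ _ → z≤n
... | false with findF (λ i → p (suc i)) in r
findF-just {suc n} {p} refl | false | just i with pi , least ← findF-just r = pi , min
  where
  min : ∀ y → p y ≡ true → suc (toℕ i) ℕ.≤ toℕ y
  min zero    e = contradiction (≡.trans (≡.sym e) q) true≢false
  min (suc y) e = s≤s (least y e)

findF-nothing : ∀ {n} {p : Fin n → Bool} → findF p ≡ nothing → ∀ i → p i ≡ false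
findF-nothing {suc n} {p} e i with p zero in q
findF-nothing {suc n} {p} () i | true
... | false with findF (λ i → p (suc i)) in r
findF-nothing {suc n} {p} e zero    | false | nothing = q
findF-nothing {suc n} {p} e (suc i) | false | nothing = findF-nothing r i

findF-found : ∀ {n} {p : Fin n → Bool} i → p i ≡ true → ∃ λ x → findF p ≡ just x
findF-found {p = p} i e with findF p in q
... | just x  = x , refl
... | nothing = contradiction (≡.trans (≡.sym e) (findF-nothing q i)) true≢false

findF-unique : ∀ {n} {p : Fin n → Bool} i → p i ≡ true → (∀ j → p j ≡ true → j ≡ i) →
               findF p ≡ just i
findF-unique i e uniq with x , q ← findF-found i e =
  ≡.trans q (cong just (uniq x (proj₁ (findF-just q))))

countF-cong : ∀ {n} {p q : Fin n → Bool} → p ≗ q → countF p ≡ countF q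
countF-cong {zero}  e = refl
countF-cong {suc n} e =
  cong₂ ℕ._+_ (cong (λ b → if b then 1 else 0) (e zero)) (countF-cong (e ∘ suc))

countF≤n : ∀ {n} (p : Fin n → Bool) → countF p ℕ.≤ n
countF≤n {zero}  p = z≤n
countF≤n {suc n} p with p zero
... | true  = s≤s (countF≤n (p ∘ suc))
... | false = ℕₚ.m≤n⇒m≤1+n (countF≤n (p ∘ suc))

countF-mono : ∀ {n} {p q : Fin n → Bool} → (∀ i → p i ≡ true → q i ≡ true) → countF p ℕ.≤ countF q
countF-mono {zero}  f = z≤n
countF-mono {suc n} {p} {q} f with p zero | q zero | f zero
... | false | true  | _ = ℕₚ.m≤n⇒m≤1+n (countF-mono (f ∘ suc))
... | false | false | _ = countF-mono (f ∘ suc)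
... | true  | true  | _ = s≤s (countF-mono (f ∘ suc))
... | true  | false | g = contradiction (g refl) λ ()

countF-none : ∀ {n} {p : Fin n → Bool} → (∀ i → p i ≡ false) → countF p ≡ 0
countF-none {zero}  f = refl
countF-none {suc n} f rewrite f zero = countF-none (f ∘ suc)

countF≡0⇒none : ∀ {n} {p : Fin n → Bool} → countF p ≡ 0 → ∀ i → p i ≡ false
countF≡0⇒none {suc n} {p} e i with p zero in q
countF≡0⇒none {suc n} {p} e zero    | false = q
countF≡0⇒none {suc n} {p} e (suc i) | false = countF≡0⇒none e i

countF>0⇒some : ∀ {n} {p : Fin n → Bool} {m} → countF p ≡ suc m → ∃ λ i → p i ≡ true
countF>0⇒some {suc n} {p} e with p zero in q
... | true  = zero , q
... | false with i , r ← countF>0⇒some e = suc i , r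

-- The conjunction has the shape of the test by which `walkPhase` looks for the next vertex, so the
-- same lemmas serve for counting and for following a cycle.
_∖_ : ∀ {n} → (Fin n → Bool) → Fin n → Fin n → Bool
(p ∖ a) l = p l ∧ not (l ==F a)

∖⁺ : ∀ {n} {p : Fin n → Bool} {a l} → p l ≡ true → l ≢ a → (p ∖ a) l ≡ true
∖⁺ pl l≢a = ∧-true⁺ pl (not-true⁺ (≢⇒==F l≢a))

∖⁻ : ∀ {n} {p : Fin n → Bool} {a l} → (p ∖ a) l ≡ true → p l ≡ true × l ≢ a
∖⁻ e with pl , q ← ∧-true⁻ e = pl , ==F-false⇒≢ (not-true⁻ q)

countF-remove : ∀ {n} {p : Fin n → Bool} a → p a ≡ true → countF p ≡ suc (countF (p ∖ a))
countF-remove {suc n} {p} zero e rewrite e =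
  cong suc (countF-cong λ i → ⇔⇒≡ (λ q → ∖⁺ {p = p} {zero} {suc i} q λ ()) (proj₁ ∘ ∖⁻ {p = p} {zero} {suc i}))
countF-remove {suc n} {p} (suc a) e = ≡.trans
  (cong ((if p zero then 1 else 0) ℕ.+_) (≡.trans (countF-remove a e) (cong suc (countF-cong λ i →
    cong (λ b → p (suc i) ∧ not b) (≡.sym (==F-suc i a))))))
  (≡.trans (ℕₚ.+-suc _ _) (cong (λ b → suc ((if b then 1 else 0) ℕ.+ countF (λ i → (p ∖ suc a) (suc i)))) (∧-true p0)))
  where
  p0 = p zero
  ∧-true : ∀ b → b ≡ b ∧ true
  ∧-true true = refl
  ∧-true false = refl

countF≡1⇒ : ∀ {n} {p : Fin n → Bool} → countF p ≡ 1 →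
            ∃ λ a → p a ≡ true × (∀ l → p l ≡ true → l ≡ a)
countF≡1⇒ {p = p} e with a , pa ← countF>0⇒some {p = p} e = a , pa , uniq
  where
  empty : countF (p ∖ a) ≡ 0
  empty = ℕₚ.suc-injective (≡.trans (≡.sym (countF-remove {p = p} a pa)) e)
  uniq : ∀ l → p l ≡ true → l ≡ a
  uniq l pl with l Fin.≟ a
  ... | yes l≡a = l≡a
  ... | no  l≢a = contradiction (≡.trans (≡.sym (∖⁺ {p = p} pl l≢a)) (countF≡0⇒none empty l)) true≢false

countF≡2⇒ : ∀ {n} {p : Fin n → Bool} → countF p ≡ 2 →
            ∃ λ a → ∃ λ z → a ≢ z × p a ≡ true × p z ≡ true × (∀ l → p l ≡ true → l ≡ a ⊎ l ≡ z)
countF≡2⇒ {p = p} e with a , pa ← countF>0⇒some {p = p} e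
  with z , pz , uniq ← countF≡1⇒ {p = p ∖ a} (ℕₚ.suc-injective (≡.trans (≡.sym (countF-remove {p = p} a pa)) e))
  = a , z , (λ a≡z → proj₂ (∖⁻ {p = p} pz) (≡.sym a≡z)) , pa , proj₁ (∖⁻ {p = p} pz) , cover
  where
  cover : ∀ l → p l ≡ true → l ≡ a ⊎ l ≡ z
  cover l pl with l Fin.≟ a
  ... | yes l≡a = inj₁ l≡a
  ... | no  l≢a = inj₂ (uniq l (∖⁺ {p = p} pl l≢a))

countF-one : ∀ {n} {p : Fin n → Bool} a → p a ≡ true → (∀ l → p l ≡ true → l ≡ a) → countF p ≡ 1
countF-one {p = p} a pa uniq = ≡.trans (countF-remove {p = p} a pa)
  (cong suc (countF-none λ i → ¬-not λ q → let pi , i≢a = ∖⁻ {p = p} q in i≢a (uniq i pi)))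

countF-two : ∀ {n} {p : Fin n → Bool} a z → a ≢ z → p a ≡ true → p z ≡ true →
             (∀ l → p l ≡ true → l ≡ a ⊎ l ≡ z) → countF p ≡ 2
countF-two {p = p} a z a≢z pa pz cover = ≡.trans (countF-remove {p = p} a pa)
  (cong suc (countF-one z (∖⁺ {p = p} pz (a≢z ∘ ≡.sym)) λ l q →
    let pl , l≢a = ∖⁻ {p = p} q in [ (λ e → contradiction e l≢a) , id ]′ (cover l pl)))

-- Pigeonhole: if y were missed, punching y out of the codomain would inject `Fin (suc n)` into
-- `Fin n`.
injective⇒surjective : ∀ {n} {f : Fin n → Fin n} → (∀ {i j} → f i ≡ f j → i ≡ j) → ∀ y → ∃ λ x → f x ≡ y
injective⇒surjective {suc n} {f} inj y with Finₚ.any? (λ x → f x Fin.≟ y)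
... | yes p = p
... | no ¬p = contradiction (Finₚ.injective⇒≤ {f = g} λ {i} {j} e → inj (Finₚ.punchOut-injective (miss i) (miss j) e)) (ℕₚ.<⇒≱ ℕₚ.≤-refl)
  where
  miss : ∀ x → y ≢ f x
  miss x e = ¬p (x , ≡.sym e)
  g : Fin (suc n) → Fin n
  g x = punchOut (miss x)

record Inverses {n} (σ τ : Fin n → Fin n) : Set where
  constructor inverses
  field
    τσ : ∀ k → τ (σ k) ≡ k
    στ : ∀ k → σ (τ k) ≡ k

  σ-injective : ∀ {i j} → σ i ≡ σ j → i ≡ j
  σ-injective {i} {j} e = ≡.trans (≡.sym (τσ i)) (≡.trans (cong τ e) (τσ j))
open Inverses public

Inverses-sym : ∀ {n} {σ τ : Fin n → Fin n} → Inverses σ τ → Inverses τ σ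
Inverses-sym (inverses a b) = inverses b a

rightInverse⇒Inverses : ∀ {n} {σ τ : Fin n → Fin n} → (∀ k → σ (τ k) ≡ k) → Inverses σ τ
rightInverse⇒Inverses {σ = σ} {τ} στ = inverses left στ
  where
  left : ∀ k → τ (σ k) ≡ k
  left k with l , refl ← injective⇒surjective {f = τ}
    (λ {i} {j} e → ≡.trans (≡.sym (στ i)) (≡.trans (cong σ e) (στ j))) k = cong τ (στ l)

-- Walks, components and their representatives

Edge : ∀ {n} → ESet n → Fin n → Fin n → Set
Edge E k l = adjE E k l ≡ true

Connected : ∀ {n} → ESet n → Fin n → Fin n → Set
Connected E = Star (Edge E)

Symmetric : ∀ {n} → ESet n → Set
Symmetric E = ∀ {k l} → Edge E k l → Edge E l k

Irreflexive : ∀ {n} → ESet n → Set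
Irreflexive E = ∀ {k l} → Edge E k l → k ≢ l

reachW-refl : ∀ {n} (E : ESet n) m k → reachW E m k k ≡ true
reachW-refl E zero    k = ≡⇒==F refl
reachW-refl E (suc m) k = ∨-true⁺ˡ (reachW-refl E m k)

reachW-step : ∀ {n} (E : ESet n) m {k j l} → reachW E m k j ≡ true → Edge E j l → reachW E (suc m) k l ≡ true
reachW-step E m {k} {j} {l} r e = ∨-true⁺ʳ {reachW E m k l} (anyF⁺ j (∧-true⁺ r e))

reachW⇒Connected : ∀ {n} (E : ESet n) m {k l} → reachW E m k l ≡ true → Connected E k l
reachW⇒Connected E zero    r rewrite ==F⇒≡ r = ε
reachW⇒Connected E (suc m) {k} {l} r with ∨-true⁻ {reachW E m k l} r
... | inj₁ r′ = reachW⇒Connected E m r′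
... | inj₂ r′ with j , q ← anyF⁻ r′ =
  let r″ , e = ∧-true⁻ {reachW E m k j} q in reachW⇒Connected E m r″ ◅◅ (e ◅ ε)

ClosedFrom : ∀ {n} → ESet n → ℕ → Fin n → Set
ClosedFrom E m k = ∀ {j l} → reachW E m k j ≡ true → Edge E j l → reachW E m k l ≡ true

-- Until it stabilises, the set reached by walks of length ≤ m gains a vertex at each step.
reachW-grows : ∀ {n} (E : ESet n) m k → ClosedFrom E m k ⊎ m ℕ.< countF (reachW E m k)
reachW-grows E zero k = inj₂ (ℕₚ.≤-reflexive (≡.sym (countF-one k (≡⇒==F refl) λ l q → ≡.sym (==F⇒≡ q))))
reachW-grows {n} E (suc m) k
  with reachW-grows E m k | Finₚ.any? (λ l → (reachW E (suc m) k l ∧ not (reachW E m k l)) Data.Bool.≟ true)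
... | inj₁ closed | _ = inj₁ λ r e → ∨-true⁺ˡ (closed (shrink r) e)
  where
  shrink : ∀ {j} → reachW E (suc m) k j ≡ true → reachW E m k j ≡ true
  shrink {j} r with ∨-true⁻ {reachW E m k j} r
  ... | inj₁ r′ = r′
  ... | inj₂ r′ with i , q ← anyF⁻ r′ = let r″ , e = ∧-true⁻ {reachW E m k i} q in closed r″ e
-- The vertex l is new at length m + 1, so the old set still fits into the new one after l is
-- removed.
... | inj₂ m< | yes (l , q) = inj₂ (ℕₚ.<-≤-trans (s≤s m<)
  (ℕₚ.≤-trans (s≤s (countF-mono {p = reachW E m k} {reachW E (suc m) k ∖ l} λ i r → ∖⁺ {p = reachW E (suc m) k} (∨-true⁺ˡ r)
      λ { refl → true≢false (≡.trans (≡.sym r) (not-true⁻ (proj₂ (∧-true⁻ {reachW E (suc m) k l} q)))) }))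
    (ℕₚ.≤-reflexive (≡.sym (countF-remove {p = reachW E (suc m) k} l (proj₁ (∧-true⁻ q)))))))
... | inj₂ m< | no ¬new = inj₁ λ {j} {l} r e → reachW-step E m (shrink j r) e
  where
  shrink : ∀ j → reachW E (suc m) k j ≡ true → reachW E m k j ≡ true
  shrink j r with bool-split (reachW E m k j)
  ... | inj₁ q = q
  ... | inj₂ q = contradiction (j , ∧-true⁺ {reachW E (suc m) k j} r (not-true⁺ q)) ¬new

-- Growth through all n steps would produce more than n vertices, so stabilisation has occurred by
-- length n.
reach-closed : ∀ {n} (E : ESet n) k → ClosedFrom E n k
reach-closed {n} E k with reachW-grows E n k
... | inj₁ closed = closed
... | inj₂ n< = contradiction n< (ℕₚ.≤⇒≯ (countF≤n (reachW E n k)))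

Connected⇒reach : ∀ {n} (E : ESet n) {k l} → Connected E k l → reach E k l ≡ true
Connected⇒reach {n} E {k} = go (reachW-refl E n k)
  where
  go : ∀ {j l} → reach E k j ≡ true → Connected E j l → reach E k l ≡ true
  go r ε        = r
  go r (e ◅ es) = go (reach-closed E k r e) es

reach⇒Connected : ∀ {n} (E : ESet n) {k l} → reach E k l ≡ true → Connected E k l
reach⇒Connected {n} E = reachW⇒Connected E n

-- Taking the least vertex makes the representative depend only on the component and agree with the
-- index comparison in `isRep`.
least-reachable : ∀ {n} (E : ESet n) k →
                  ∃ λ r → Connected E k r × (∀ l → Connected E k l → toℕ r ℕ.≤ toℕ l)
least-reachable {n} E k with r , e ← findF-found {p = reach E k} k (reachW-refl E n k) =
  let r-reach , least = findF-just e in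
  r , reach⇒Connected E r-reach , λ l c → least l (Connected⇒reach E c)

rep : ∀ {n} → ESet n → Fin n → Fin n
rep E k = proj₁ (least-reachable E k)

rep-connected : ∀ {n} (E : ESet n) k → Connected E k (rep E k)
rep-connected E k = proj₁ (proj₂ (least-reachable E k))

rep-least : ∀ {n} (E : ESet n) {k l} → Connected E k l → toℕ (rep E k) ℕ.≤ toℕ l
rep-least E {k} = proj₂ (proj₂ (least-reachable E k)) _

rep-cong : ∀ {n} (E : ESet n) → Symmetric E → ∀ {k l} → Connected E k l → rep E k ≡ rep E l
rep-cong E s {k} {l} c = Finₚ.toℕ-injective (ℕₚ.≤-antisym
  (rep-least E (c ◅◅ rep-connected E l))
  (rep-least E (reverse s c ◅◅ rep-connected E k)))

rep-idem : ∀ {n} (E : ESet n) → Symmetric E → ∀ k → rep E (rep E k) ≡ rep E k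
rep-idem E s k = ≡.sym (rep-cong E s (rep-connected E k))

isRep≡ : ∀ {n} (E : ESet n) k → isRep E k ≡ (rep E k ==F k)
isRep≡ {n} E k = ⇔⇒≡ to from
  where
  to : isRep E k ≡ true → (rep E k ==F k) ≡ true
  to q = ≡⇒==F (Finₚ.toℕ-injective (ℕₚ.≤-antisym (rep-least E ε)
    (≤ᵇ-true⁻ (⇒-true⁻ (allF⁻ q (rep E k)) (Connected⇒reach E (rep-connected E k))))))
  from : (rep E k ==F k) ≡ true → isRep E k ≡ true
  from q = allF⁺ λ l → ⇒-true⁺ {reach E k l} λ r →
    ≤ᵇ-true⁺ (subst (λ x → toℕ x ℕ.≤ toℕ l) (==F⇒≡ q) (rep-least E (reach⇒Connected E r)))

invariant-rep : ∀ {n} (E : ESet n) {A : Set} (g : Fin n → A) →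
                (∀ {k l} → Edge E k l → g k ≡ g l) → ∀ {k l} → Connected E k l → g k ≡ g l
invariant-rep E g inv ε        = refl
invariant-rep E g inv (e ◅ es) = ≡.trans (inv e) (invariant-rep E g inv es)

-- Colouring of edge ends and existence of orientations

HalfEdge : ℕ → Set
HalfEdge n = Fin n × Bool

-- Proved by deleting vertex 0 and joining the partners of its two half-edges.
halfEdge-colouring : ∀ {n} (ρ : HalfEdge n → HalfEdge n) → (∀ x → ρ (ρ x) ≡ x) → (∀ x → ρ x ≢ x) →
  ∃ λ (col : HalfEdge n → Bool) →
    (∀ v d → col (v , not d) ≡ not (col (v , d))) × (∀ x → col (ρ x) ≡ not (col x))
halfEdge-colouring {zero}  ρ inv fpf = (λ _ → true) , (λ ()) , λ ()
halfEdge-colouring {suc n} ρ inv fpf = col , col-not , col-ρ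
  where
  up : HalfEdge n → HalfEdge (suc n)
  up (v , d) = suc v , d

  up-injective : ∀ {x y} → up x ≡ up y → x ≡ y
  up-injective refl = refl

  ρ-swap : ∀ {x y} → ρ x ≡ y → ρ y ≡ x
  ρ-swap refl = inv _

  Joined : HalfEdge n → HalfEdge n → Set
  Joined x y = ρ (up x) ≡ up y ⊎ ∃ λ e → ρ (up x) ≡ (zero , e) × ρ (zero , not e) ≡ up y

  zero-partner : ∀ {e e′} → ρ (zero , e) ≡ (zero , e′) → e′ ≡ not e
  zero-partner {false} {false} q = contradiction q (fpf _)
  zero-partner {false} {true}  q = refl
  zero-partner {true}  {false} q = refl
  zero-partner {true}  {true}  q = contradiction q (fpf _)

  join : ∀ x → ∃ (Joined x)
  join x with ρ (up x) in q
  ... | suc w , e = (w , e) , inj₁ refl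
  ... | zero , e with ρ (zero , not e) in r
  ...   | suc w , e′ = (w , e′) , inj₂ (e , refl , r)
  -- If the other end at 0 had its partner at 0 as well, that partner would be `(zero , e)`, which
  -- is already matched with `up x`.
  ...   | zero , e′ = contradiction (≡.trans (≡.sym (ρ-swap q)) (ρ-swap r′)) λ ()
    where
    r′ : ρ (zero , not e) ≡ (zero , e)
    r′ = ≡.trans r (cong (zero ,_) (≡.trans (zero-partner r) (not-involutive e)))

  Joined-sym : ∀ {x y} → Joined x y → Joined y x
  Joined-sym (inj₁ q) = inj₁ (ρ-swap q)
  Joined-sym (inj₂ (e , q , r)) =
    inj₂ (not e , ρ-swap r , ≡.trans (cong (λ d → ρ (zero , d)) (not-involutive e)) (ρ-swap q))

  Joined-functional : ∀ {x y z} → Joined x y → Joined x z → y ≡ z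
  Joined-functional (inj₁ q) (inj₁ q′) = up-injective (≡.trans (≡.sym q) q′)
  Joined-functional (inj₁ q) (inj₂ (_ , q′ , _)) = contradiction (≡.trans (≡.sym q) q′) λ ()
  Joined-functional (inj₂ (_ , q , _)) (inj₁ q′) = contradiction (≡.trans (≡.sym q) q′) λ ()
  Joined-functional (inj₂ (_ , q , r)) (inj₂ (_ , q′ , r′)) with refl ← ≡.trans (≡.sym q) q′ =
    up-injective (≡.trans (≡.sym r) r′)

  ρ′ : HalfEdge n → HalfEdge n
  ρ′ x = proj₁ (join x)

  ρ′-fpf : ∀ x → ρ′ x ≢ x
  ρ′-fpf x q with subst (Joined x) q (proj₂ (join x))
  ... | inj₁ r = fpf _ r
  -- Both ends at vertex 0 would have the single partner `up x`.
  ... | inj₂ (e , r , s) = not-¬ {e} {e} refl (,-injectiveʳ (≡.trans (≡.sym r) (ρ-swap s)))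

  ih : ∃ λ (col : HalfEdge n → Bool) →
    (∀ v d → col (v , not d) ≡ not (col (v , d))) × (∀ x → col (ρ′ x) ≡ not (col x))
  ih = halfEdge-colouring ρ′
    (λ x → Joined-functional (proj₂ (join (ρ′ x))) (Joined-sym (proj₂ (join x)))) ρ′-fpf

  col′ : HalfEdge n → Bool
  col′ = proj₁ ih

  opposite : HalfEdge (suc n) → Bool
  opposite (suc w , e) = not (col′ (w , e))
  -- Reached only if the two ends at 0 are partners of each other; then either colour is good for
  -- the first of them.
  opposite (zero  , e) = false

  col : HalfEdge (suc n) → Bool
  col (suc v , d)    = col′ (v , d)
  col (zero , false) = opposite (ρ (zero , false))
  col (zero , true)  = not (opposite (ρ (zero , false)))

  col-not : ∀ v d → col (v , not d) ≡ not (col (v , d))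
  col-not (suc v) d    = proj₁ (proj₂ ih) v d
  col-not zero   false = refl
  col-not zero   true  = ≡.sym (not-involutive _)

  col-zero : ∀ x e → ρ (zero , e) ≡ up x → ρ (zero , not e) ≡ up (ρ′ x) → col (zero , e) ≡ not (col′ x)
  col-zero x false q r = cong opposite q
  -- The colour of vertex 0 was dictated by its `false` end. It also suits the `true` end, because x
  -- and `ρ′ x` have different colours by induction.
  col-zero x true  q r = cong not (≡.trans (cong opposite r)
    (≡.trans (cong not (proj₂ (proj₂ ih) x)) (not-involutive _)))

  col-up : ∀ x → col (ρ (up x)) ≡ not (col′ x)
  col-up x with proj₂ (join x)
  ... | inj₁ q = ≡.trans (cong col q) (proj₂ (proj₂ ih) x)
  ... | inj₂ (e , q , r) = ≡.trans (cong col q) (col-zero x e (ρ-swap q) r)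

  col-ρ : ∀ x → col (ρ x) ≡ not (col x)
  col-ρ (suc v , d) = col-up (v , d)
  col-ρ (zero , e) with ρ (zero , e) in q
  ... | zero , e′ = ≡.trans (cong (λ d → col (zero , d)) (zero-partner q)) (col-not zero e)
  ... | suc w , d = ≡.sym (≡.trans (cong not
        (≡.trans (cong col (≡.sym (ρ-swap q))) (col-up (w , d)))) (not-involutive _))

-- σ orients the components of E cyclically; a single edge becomes a 2-cycle.
record Orients {n} (E : ESet n) (σ τ : Fin n → Fin n) : Set where
  field
    inverse : Inverses σ τ
    edge    : ∀ v → Edge E v (σ v)
    cover   : ∀ {v l} → Edge E v l → l ≡ σ v ⊎ l ≡ τ v
open Orients public

-- The local form of `isElementary`: degrees are compared along single edges, so reachability
-- disappears.
record Regular {n} (E : ESet n) : Set where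
  field
    symm   : Symmetric E
    loopless : Irreflexive E
    deg∈   : ∀ v → degE E v ≡ 1 ⊎ degE E v ≡ 2
    deg≡   : ∀ {v w} → Edge E v w → degE E v ≡ degE E w
open Regular public

-- A vertex is left by its end coloured `true` and entered by its end coloured `false`. Every edge
-- has one end of each colour, so moving along `true` ends and moving along `false` ends undo each
-- other.
orientation : ∀ {n} (E : ESet n) → Regular E → ∃ λ σ → ∃ λ τ → Orients E σ τ
orientation {n} E reg = σ , τ , record
  { inverse = inverses τσ′ στ′
  ; edge    = λ v → nbr-edge v (o v)
  ; cover   = cover′ }
  where
  -- At a vertex of degree 1 both fields hold the only neighbour: a single edge is treated as a
  -- double edge, so that every vertex has two ends.
  record Nbrs (v : Fin n) : Set where
    field
      first last : Fin n
      edge₁      : Edge E v first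
      edge₂      : Edge E v last
      either     : ∀ {l} → Edge E v l → l ≡ first ⊎ l ≡ last
      one        : degE E v ≡ 1 → first ≡ last
      two        : degE E v ≡ 2 → first ≢ last
  open Nbrs

  nbrs : ∀ v → Nbrs v
  nbrs v with deg∈ reg v
  ... | inj₁ d≡1 = let a , e , uniq = countF≡1⇒ {p = adjE E v} d≡1 in record
    { first = a ; last = a ; edge₁ = e ; edge₂ = e ; either = λ q → inj₁ (uniq _ q)
    ; one = λ _ → refl ; two = λ d≡2 → contradiction (≡.trans (≡.sym d≡1) d≡2) λ () }
  ... | inj₂ d≡2 = let a , z , a≢z , e , f , cov = countF≡2⇒ {p = adjE E v} d≡2 in record
    { first = a ; last = z ; edge₁ = e ; edge₂ = f ; either = cov _
    ; one = λ d≡1 → contradiction (≡.trans (≡.sym d≡1) d≡2) λ () ; two = λ _ → a≢z }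

  nbr : Fin n → Bool → Fin n
  nbr v d = if d then last (nbrs v) else first (nbrs v)

  nbr-edge : ∀ v d → Edge E v (nbr v d)
  nbr-edge v false = edge₁ (nbrs v)
  nbr-edge v true  = edge₂ (nbrs v)

  nbr-onto : ∀ {v l} → Edge E v l → ∃ λ d → nbr v d ≡ l
  nbr-onto {v} e with either (nbrs v) e
  ... | inj₁ q = false , ≡.sym q
  ... | inj₂ q = true  , ≡.sym q

  nbr-one : ∀ {v} → degE E v ≡ 1 → ∀ d d′ → nbr v d ≡ nbr v d′
  nbr-one {v} q false false = refl
  nbr-one {v} q false true  = one (nbrs v) q
  nbr-one {v} q true  false = ≡.sym (one (nbrs v) q)
  nbr-one {v} q true  true  = refl

  -- Label at w of the edge that leaves v by its end d. On a double edge the labels are exchanged;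
  -- otherwise the two neighbours of w differ, and the label tells which of them is v.
  end : Fin n → Bool → Fin n → Bool
  end v d w = if degE E v ℕ.≡ᵇ 1 then not d else (last (nbrs w) ==F v)

  ρ : HalfEdge n → HalfEdge n
  ρ (v , d) = nbr v d , end v d (nbr v d)

  not-one : ∀ {v} → degE E v ≡ 2 → (degE E v ℕ.≡ᵇ 1) ≡ false
  not-one q rewrite q = refl

  back : ∀ v d → nbr (nbr v d) (end v d (nbr v d)) ≡ v
  back v d = go (deg∈ reg v) (nbr-onto (symm reg (nbr-edge v d)))
    where
    w = nbr v d
    go : degE E v ≡ 1 ⊎ degE E v ≡ 2 → (∃ λ e → nbr w e ≡ v) → nbr w (end v d w) ≡ v
    go (inj₁ q) (e , r) = ≡.trans (nbr-one (≡.trans (≡.sym (deg≡ reg (nbr-edge v d))) q) _ e) r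
    go (inj₂ q) (e , r) rewrite not-one q with last (nbrs w) ==F v in s | e
    ... | true  | _     = ==F⇒≡ s
    ... | false | false = r
    ... | false | true  = contradiction r (==F-false⇒≢ s)

  end-end : ∀ v d → end (nbr v d) (end v d (nbr v d)) v ≡ d
  end-end v d = go (deg∈ reg v)
    where
    last? : degE E v ≡ 2 → ∀ d → (last (nbrs v) ==F nbr v d) ≡ d
    last? q true  = ≡⇒==F refl
    last? q false = ≢⇒==F (two (nbrs v) q ∘ ≡.sym)
    go : degE E v ≡ 1 ⊎ degE E v ≡ 2 → end (nbr v d) (end v d (nbr v d)) v ≡ d
    go (inj₁ q) rewrite q | ≡.trans (≡.sym (deg≡ reg (nbr-edge v d))) q = not-involutive d
    go (inj₂ q) rewrite not-one q | not-one (≡.trans (≡.sym (deg≡ reg (nbr-edge v d))) q) = last? q d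

  ρ-involutive : ∀ x → ρ (ρ x) ≡ x
  ρ-involutive (v , d) = cong₂ _,_ (back v d)
    (≡.trans (cong (end (nbr v d) (end v d (nbr v d))) (back v d)) (end-end v d))

  colouring : ∃ λ (col : HalfEdge n → Bool) →
    (∀ v d → col (v , not d) ≡ not (col (v , d))) × (∀ x → col (ρ x) ≡ not (col x))
  colouring = halfEdge-colouring ρ ρ-involutive
    λ { (v , d) q → loopless reg (nbr-edge v d) (≡.sym (,-injectiveˡ q)) }

  col : HalfEdge n → Bool
  col = proj₁ colouring

  o : Fin n → Bool
  o v = col (v , true)

  col-o : ∀ v d → col (v , d) ≡ (if d then o v else not (o v))
  col-o v true  = refl
  col-o v false = proj₁ (proj₂ colouring) v true

  col⇒o : ∀ {v d} → col (v , d) ≡ true → d ≡ o v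
  col⇒o {v} {true}  q = ≡.sym q
  col⇒o {v} {false} q = ≡.sym (not-true⁻ (≡.trans (≡.sym (col-o v false)) q))

  ¬col⇒o : ∀ {v d} → col (v , d) ≡ false → d ≡ not (o v)
  ¬col⇒o {v} {true}  q = cong not (≡.sym q)
  ¬col⇒o {v} {false} q = ≡.trans (≡.sym q) (col-o v false)

  o⇒col : ∀ v → col (v , o v) ≡ true
  o⇒col v with o v in q
  ... | true  = q
  ... | false = ≡.trans (col-o v false) (cong not q)

  notO⇒col : ∀ v → col (v , not (o v)) ≡ false
  notO⇒col v = ≡.trans (proj₁ (proj₂ colouring) v (o v)) (cong not (o⇒col v))

  σ τ : Fin n → Fin n
  σ v = nbr v (o v)
  τ v = nbr v (not (o v))

  τσ′ : ∀ v → τ (σ v) ≡ v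
  τσ′ v = ≡.trans (cong (nbr (σ v)) (≡.sym (¬col⇒o
    (≡.trans (proj₂ (proj₂ colouring) (v , o v)) (cong not (o⇒col v)))))) (back v (o v))

  στ′ : ∀ v → σ (τ v) ≡ v
  στ′ v = ≡.trans (cong (nbr (τ v)) (≡.sym (col⇒o
    (≡.trans (proj₂ (proj₂ colouring) (v , not (o v))) (cong not (notO⇒col v)))))) (back v (not (o v)))

  cover′ : ∀ {v l} → Edge E v l → l ≡ σ v ⊎ l ≡ τ v
  cover′ {v} e with nbr-onto e
  ... | d , q with col (v , d) in r
  ...   | true  = inj₁ (≡.trans (≡.sym q) (cong (nbr v) (col⇒o r)))
  ...   | false = inj₂ (≡.trans (≡.sym q) (cong (nbr v) (¬col⇒o r)))

-- Supports of permutations and reversal of components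

ESet-ext : ∀ {n} {E F : ESet n} → (∀ k l → adjE E k l ≡ adjE F k l) → E ≡ F
ESet-ext {E = E} {F} eq = ext λ k → ext (eq k)
  where
  ext : ∀ {A : Set} {m} {xs ys : Vec A m} → (∀ i → lookup xs i ≡ lookup ys i) → xs ≡ ys
  ext {xs = xs} {ys} e = ≡.trans (≡.sym (Vecₚ.tabulate∘lookup xs)) (≡.trans (Vecₚ.tabulate-cong e) (Vecₚ.tabulate∘lookup ys))

-- A fixed point of σ leaves a loop here, and such a support is never a subgraph of a mixed graph.
support : ∀ {n} → (Fin n → Fin n) → ESet n
support σ = tabulate λ k → tabulate λ l → (σ k ==F l) ∨ (σ l ==F k)

adj-support : ∀ {n} (σ : Fin n → Fin n) k l → adjE (support σ) k l ≡ (σ k ==F l) ∨ (σ l ==F k)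
adj-support σ k l = ≡.trans
  (cong (λ row → lookup row l) (Vecₚ.lookup∘tabulate (λ k → tabulate λ l → (σ k ==F l) ∨ (σ l ==F k)) k))
  (Vecₚ.lookup∘tabulate (λ l → (σ k ==F l) ∨ (σ l ==F k)) l)

support-edge⁻ : ∀ {n} (σ : Fin n → Fin n) {k l} → Edge (support σ) k l → σ k ≡ l ⊎ σ l ≡ k
support-edge⁻ σ {k} {l} e with ∨-true⁻ {σ k ==F l} (≡.trans (≡.sym (adj-support σ k l)) e)
... | inj₁ q = inj₁ (==F⇒≡ q)
... | inj₂ q = inj₂ (==F⇒≡ q)

support-edge⁺ : ∀ {n} (σ : Fin n → Fin n) {k l} → σ k ≡ l ⊎ σ l ≡ k → Edge (support σ) k l
support-edge⁺ σ {k} {l} (inj₁ q) = ≡.trans (adj-support σ k l) (∨-true⁺ˡ (≡⇒==F q))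
support-edge⁺ σ {k} {l} (inj₂ q) = ≡.trans (adj-support σ k l) (∨-true⁺ʳ (≡⇒==F q))

support-symmetric : ∀ {n} (σ : Fin n → Fin n) → Symmetric (support σ)
support-symmetric σ = support-edge⁺ σ ∘ [ inj₂ , inj₁ ]′ ∘ support-edge⁻ σ

support-cong : ∀ {n} {σ σ′ : Fin n → Fin n} → σ ≗ σ′ → support σ ≡ support σ′
support-cong e = Vecₚ.tabulate-cong λ k → Vecₚ.tabulate-cong λ l →
  cong₂ (λ x y → (x ==F l) ∨ (y ==F k)) (e k) (e l)

inverses⇒Orients : ∀ {n} {σ τ : Fin n → Fin n} → Inverses σ τ → Orients (support σ) σ τ
inverses⇒Orients {σ = σ} {τ} i = record
  { inverse = i
  ; edge    = λ v → support-edge⁺ σ (inj₁ refl)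
  ; cover   = λ e → [ inj₁ ∘ ≡.sym , (λ q → inj₂ (≡.trans (≡.sym (τσ i _)) (cong τ q))) ]′ (support-edge⁻ σ e) }

Orients⇒support : ∀ {n} {E : ESet n} {σ τ} → Symmetric E → Orients E σ τ → support σ ≡ E
Orients⇒support {E = E} {σ} {τ} s o = ESet-ext λ k l → ⇔⇒≡
  ([ (λ { refl → edge o k }) , (λ { refl → s (edge o l) }) ]′ ∘ support-edge⁻ σ)
  (support-edge⁺ σ ∘ [ inj₁ ∘ ≡.sym , (λ q → inj₂ (≡.trans (cong σ q) (στ (inverse o) k))) ]′ ∘ cover o)

module _ {n} {E : ESet n} {σ τ : Fin n → Fin n} (s : Symmetric E) (o : Orients E σ τ) where

  edge-τ : ∀ v → Edge E v (τ v)
  edge-τ v = s (subst (Edge E (τ v)) (στ (inverse o) v) (edge o (τ v)))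

  degE-one : ∀ {v} → σ v ≡ τ v → degE E v ≡ 1
  degE-one {v} q = countF-one (σ v) (edge o v) λ l e → [ id , (λ r → ≡.trans r (≡.sym q)) ]′ (cover o e)

  degE-two : ∀ {v} → σ v ≢ τ v → degE E v ≡ 2
  degE-two {v} q = countF-two (σ v) (τ v) q (edge o v) (edge-τ v) λ l e → cover o e

  degE≡1⇒ : ∀ {v} → degE E v ≡ 1 → σ v ≡ τ v
  degE≡1⇒ {v} d with σ v Fin.≟ τ v
  ... | yes q = q
  ... | no ¬q = contradiction (≡.trans (≡.sym d) (degE-two ¬q)) λ ()

  degE≡2⇒ : ∀ {v} → degE E v ≡ 2 → σ v ≢ τ v
  degE≡2⇒ d q = contradiction (≡.trans (≡.sym d) (degE-one q)) λ ()

  degE-σ : ∀ v → degE E v ≡ degE E (σ v)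
  degE-σ v with σ v Fin.≟ τ v
  ... | yes q = ≡.trans (degE-one q) (≡.sym (degE-one (≡.trans (cong σ q)
        (≡.trans (στ (inverse o) v) (≡.sym (τσ (inverse o) v))))))
  ... | no ¬q = ≡.trans (degE-two ¬q) (≡.sym (degE-two λ q → ¬q
        (≡.trans (≡.sym (τσ (inverse o) (σ v))) (cong τ (≡.trans q (τσ (inverse o) v))))))

  invariant-edge : ∀ {A : Set} (g : Fin n → A) → (∀ v → g (σ v) ≡ g v) → ∀ {k l} → Edge E k l → g k ≡ g l
  invariant-edge g inv {k} {l} e with cover o e
  ... | inj₁ refl = ≡.sym (inv k)
  ... | inj₂ refl = ≡.trans (≡.sym (cong g (στ (inverse o) k))) (inv (τ k))

  Orients⇒Regular : Irreflexive E → Regular E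
  Orients⇒Regular i = record
    { symm = s ; loopless = i ; deg∈ = deg∈′ ; deg≡ = invariant-edge (degE E) (≡.sym ∘ degE-σ) }
    where
    deg∈′ : ∀ v → degE E v ≡ 1 ⊎ degE E v ≡ 2
    deg∈′ v with σ v Fin.≟ τ v
    ... | yes q = inj₁ (degE-one q)
    ... | no ¬q = inj₂ (degE-two ¬q)

  rep-σ : ∀ v → rep E (σ v) ≡ rep E v
  rep-σ v = ≡.sym (rep-cong E s (edge o v ◅ ε))

  rep-τ : ∀ v → rep E (τ v) ≡ rep E v
  rep-τ v = ≡.sym (rep-cong E s (edge-τ v ◅ ε))

  invariant⇒rep : ∀ {A : Set} (g : Fin n → A) → (∀ v → g (σ v) ≡ g v) → ∀ v → g (rep E v) ≡ g v
  invariant⇒rep g inv v = ≡.sym (invariant-rep E g (invariant-edge g inv) (rep-connected E v))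

-- The bit is read at the representative, so each component turns as a whole. Bits at other vertices
-- have no influence, which is why uniqueness later requires normalised bit vectors.
reorient : ∀ {n} → ESet n → (σ τ : Fin n → Fin n) → (Fin n → Bool) → Fin n → Fin n
reorient E σ τ b v = if b (rep E v) then σ v else τ v

if-cong : ∀ {A : Set} {b c : Bool} {x y : A} → b ≡ c → (if b then x else y) ≡ (if c then x else y)
if-cong refl = refl

reorient-orients : ∀ {n} {E : ESet n} {σ τ} → Symmetric E → Orients E σ τ → ∀ b →
                   Orients E (reorient E σ τ b) (reorient E τ σ b)
reorient-orients {E = E} {σ} {τ} s o b = record
  { inverse = inverses (left (inverse o) (rep-σ s o) (rep-τ s o)) (left (Inverses-sym (inverse o)) (rep-τ s o) (rep-σ s o))
  ; edge    = edge′
  ; cover   = cover′ }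
  where
  left : ∀ {σ τ} → Inverses σ τ → (∀ v → rep E (σ v) ≡ rep E v) → (∀ v → rep E (τ v) ≡ rep E v) →
         ∀ v → reorient E τ σ b (reorient E σ τ b v) ≡ v
  left {σ} {τ} i rσ rτ v with b (rep E v) in q
  ... | true  = ≡.trans (if-cong (≡.trans (cong b (rσ v)) q)) (τσ i v)
  ... | false = ≡.trans (if-cong (≡.trans (cong b (rτ v)) q)) (στ i v)
  edge′ : ∀ v → Edge E v (reorient E σ τ b v)
  edge′ v with b (rep E v)
  ... | true  = edge o v
  ... | false = edge-τ s o v
  cover′ : ∀ {v l} → Edge E v l → l ≡ reorient E σ τ b v ⊎ l ≡ reorient E τ σ b v
  cover′ {v} e with b (rep E v) | cover o e
  ... | true  | q      = q
  ... | false | inj₁ q = inj₂ q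
  ... | false | inj₂ q = inj₁ q

-- If both orientations pass from v to w, the vertex from which w was entered is the same for both,
-- and w has at most one other neighbour. So agreement travels along σ, and backwards by the
-- symmetric argument.
agree-invariant : ∀ {n} {E : ESet n} {σ τ σ′ τ′} → Orients E σ τ → Orients E σ′ τ′ →
                  ∀ v → (σ′ (σ v) ==F σ (σ v)) ≡ (σ′ v ==F σ v)
agree-invariant {E = E} {σ} {τ} {σ′} {τ′} o o′ v = ⇔⇒≡ (≡⇒==F ∘ back ∘ ==F⇒≡) (≡⇒==F ∘ forth ∘ ==F⇒≡)
  where
  forth : σ′ v ≡ σ v → σ′ (σ v) ≡ σ (σ v)
  forth q with cover o (edge o′ (σ v)) | cover o′ (edge o (σ v))
  ... | inj₁ r | _      = r
  ... | _      | inj₁ r = ≡.sym r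
  -- Both successors are the vertex v that was just left, as on a 2-cycle.
  ... | inj₂ r | inj₂ t = ≡.trans r (≡.trans (τσ (inverse o) v)
        (≡.sym (≡.trans t (≡.trans (cong τ′ (≡.sym q)) (τσ (inverse o′) v)))))
  back : σ′ (σ v) ≡ σ (σ v) → σ′ v ≡ σ v
  back q with cover o (edge o′ v) | cover o′ (edge o v)
  ... | inj₁ r | _      = r
  ... | _      | inj₁ r = ≡.sym r
  ... | inj₂ r | inj₂ t = ≡.trans r (≡.trans (cong τ
        (≡.trans (≡.sym (στ (inverse o′) v)) (≡.trans (cong σ′ (≡.sym t)) q))) (τσ (inverse o) (σ v)))

-- Agreement is constant on components, so comparing the orientations at the representative decides
-- it everywhere; where they disagree, `cover` leaves only the backward neighbour.
reorientation : ∀ {n} {E : ESet n} {σ τ σ′ τ′} → Symmetric E → Orients E σ τ → Orients E σ′ τ′ →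
                ∀ v → σ′ v ≡ reorient E σ τ (λ k → σ′ k ==F σ k) v
reorientation {E = E} {σ} {τ} {σ′} s o o′ v with σ′ (rep E v) ==F σ (rep E v) in q
... | true  = ==F⇒≡ (≡.trans (≡.sym (invariant⇒rep s o (λ k → σ′ k ==F σ k) (agree-invariant o o′) v)) q)
... | false with cover o (edge o′ v)
...   | inj₂ r = r
...   | inj₁ r = contradiction (≡.trans (≡.sym (≡⇒==F r))
        (≡.trans (≡.sym (invariant⇒rep s o (λ k → σ′ k ==F σ k) (agree-invariant o o′) v)) q)) true≢false

isElementary⇒Regular : ∀ {n} (E : ESet n) → Symmetric E → Irreflexive E → isElementary E ≡ true → Regular E
isElementary⇒Regular E s i el = record
  { symm = s ; loopless = i
  ; deg∈ = λ v → [ inj₁ ∘ ≡ᵇ-true⁻ , inj₂ ∘ ≡ᵇ-true⁻ ]′ (∨-true⁻ {degE E v ℕ.≡ᵇ 1} (proj₁ (∧-true⁻ (allF⁻ el v))))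
  ; deg≡ = λ {v} {w} e → ≡ᵇ-true⁻ (⇒-true⁻ {reach E v w}
      (allF⁻ (proj₂ (∧-true⁻ {(degE E v ℕ.≡ᵇ 1) ∨ (degE E v ℕ.≡ᵇ 2)} (allF⁻ el v))) w) (Connected⇒reach E (e ◅ ε))) }

Regular⇒isElementary : ∀ {n} (E : ESet n) → Regular E → isElementary E ≡ true
Regular⇒isElementary E r = allF⁺ λ v → ∧-true⁺
  ([ (λ q → ∨-true⁺ˡ (≡ᵇ-true⁺ q)) , (λ q → ∨-true⁺ʳ (≡ᵇ-true⁺ q)) ]′ (deg∈ r v))
  (allF⁺ λ w → ⇒-true⁺ {reach E v w} λ c → ≡ᵇ-true⁺ (invariant-rep E (degE E) (deg≡ r) (reach⇒Connected E c)))

isSubgraph⁻ : ∀ {n} (M : MixedGraph n) (E : ESet n) → isSubgraph M E ≡ true →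
              (∀ {k l} → Edge E k l → isEdge (kind M k l) ≡ true) × Symmetric E
isSubgraph⁻ M E sub = (λ {k} {l} → edges k l) , λ {k} {l} → sym k l
  where
  edges : ∀ k l → Edge E k l → isEdge (kind M k l) ≡ true
  edges k l e = ⇒-true⁻ (proj₁ (∧-true⁻ (allF⁻ (allF⁻ sub k) l))) e
  sym : ∀ k l → Edge E k l → Edge E l k
  sym k l e with proj₂ (∧-true⁻ {not (adjE E k l) ∨ isEdge (kind M k l)} (allF⁻ (allF⁻ sub k) l))
  ... | q rewrite e = q

-- Argued from a failing pair k, l: once both adjacency bits are known, the comparison local to
-- `isSubgraph` computes.
isSubgraph⁺ : ∀ {n} (M : MixedGraph n) (E : ESet n) →
              (∀ {k l} → Edge E k l → isEdge (kind M k l) ≡ true) → Symmetric E → isSubgraph M E ≡ true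
isSubgraph⁺ M E edges s with isSubgraph M E in q
... | true  = refl
... | false with k , r ← allF-false⁻ q with l , t ← allF-false⁻ r
    with adjE E k l in p | adjE E l k in p′ | t
...   | true  | true  | u rewrite edges p = contradiction u λ ()
...   | true  | false | _ = contradiction (≡.trans (≡.sym (s p)) p′) true≢false
...   | false | true  | _ = contradiction (≡.trans (≡.sym (s p′)) p) true≢false
...   | false | false | ()

isEdge⇒irreflexive : ∀ {n} (M : MixedGraph n) (E : ESet n) →
                     (∀ {k l} → Edge E k l → isEdge (kind M k l) ≡ true) → Irreflexive E
isEdge⇒irreflexive M E edges {k} e refl with kind M k k | irrefl M k | edges e
... | none | _ | ()

-- Cutting a vertex out of a permutation

lower : ∀ {n} → Fin n → Fin (suc n) → Fin n
lower d zero    = d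
lower d (suc m) = m

-- Shortcuts vertex 0; the innermost default is never taken when σ is injective.
contract : ∀ {n} → (Fin (suc n) → Fin (suc n)) → Fin n → Fin n
contract σ k = lower (lower k (σ zero)) (σ (suc k))

-- The map r picks a representative in each cycle of σ. That `r k` lies on the cycle of k is
-- expressed by σ-invariant Boolean functions instead of powers of σ; this form passes to the
-- shortened permutation by extending the functions.
record Classes {n} (σ r : Fin n → Fin n) : Set where
  field
    r-σ       : ∀ k → r (σ k) ≡ r k
    r-idem    : ∀ k → r (r k) ≡ r k
    connected : (g : Fin n → Bool) → (∀ k → g (σ k) ≡ g k) → ∀ k → g (r k) ≡ g k
open Classes public

module Contract {n} {σ τ : Fin (suc n) → Fin (suc n)} (i : Inverses σ τ) where

  contract-suc : ∀ {σ : Fin (suc n) → Fin (suc n)} {k m} → σ (suc k) ≡ suc m → contract σ k ≡ m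
  contract-suc {σ} {k} q rewrite q = refl

  contract-zero : ∀ {σ τ : Fin (suc n) → Fin (suc n)} → Inverses σ τ → ∀ {k} → σ (suc k) ≡ zero → σ zero ≡ suc (contract σ k)
  contract-zero {σ} i {k} q rewrite q with σ zero in p
  ... | suc j = refl
  ... | zero  = contradiction (σ-injective i (≡.trans p (≡.sym q))) λ ()

  inverse-left : ∀ {σ τ : Fin (suc n) → Fin (suc n)} → Inverses σ τ → ∀ k → contract τ (contract σ k) ≡ k
  inverse-left {σ} {τ} i k = go (σ (suc k)) refl
    where
    go : ∀ x → σ (suc k) ≡ x → contract τ (contract σ k) ≡ k
    go (suc m) q = ≡.trans (cong (contract τ) (contract-suc {σ} q))
      (contract-suc {τ} (≡.trans (cong τ (≡.sym q)) (τσ i (suc k))))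
    go zero    q = Finₚ.suc-injective (≡.trans
      (≡.sym (contract-zero (Inverses-sym i) (≡.trans (cong τ (≡.sym (contract-zero i q))) (τσ i zero))))
      (≡.trans (cong τ (≡.sym q)) (τσ i (suc k))))

  contract-inverses : Inverses (contract σ) (contract τ)
  contract-inverses = inverses (inverse-left i) (inverse-left (Inverses-sym i))

  module _ {r : Fin (suc n) → Fin (suc n)} (cl : Classes σ r) where

    -- A cycle represented by the deleted vertex 0 receives the successor of 0 as its new
    -- representative.
    r′ : Fin n → Fin n
    r′ k = lower (lower k (σ zero)) (r (suc k))

    -- When 0 is fixed, the indicator of 0 is σ-invariant, so `connected` applies to it and
    -- separates 0 from all other cycles.
    fixed⇒own-class : σ zero ≡ zero → ∀ k → (r k ==F zero) ≡ (k ==F zero)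
    fixed⇒own-class σ0 = connected cl (_==F zero) λ k → ⇔⇒≡
      (λ e → ≡⇒==F (σ-injective i (≡.trans (==F⇒≡ e) (≡.sym σ0))))
      (λ e → ≡⇒==F (≡.trans (cong σ (==F⇒≡ e)) σ0))

    fixed⇒r-suc≢0 : σ zero ≡ zero → ∀ k → r (suc k) ≢ zero
    fixed⇒r-suc≢0 σ0 k q = true≢false (≡.trans (≡.sym (≡⇒==F q)) (fixed⇒own-class σ0 (suc k)))

    r′-suc : ∀ {k m} → r (suc k) ≡ suc m → r′ k ≡ m
    r′-suc q rewrite q = refl

    r′-zero : ∀ {k} → r (suc k) ≡ zero → σ zero ≡ suc (r′ k)
    r′-zero {k} q rewrite q with σ zero in p
    ... | suc j = refl
    ... | zero  = contradiction q (fixed⇒r-suc≢0 p k)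

    r-suc-cong : ∀ {k l} → r (suc k) ≡ r (suc l) → r′ k ≡ r′ l
    r-suc-cong {k} {l} e = go (r (suc l)) refl
      where
      go : ∀ x → r (suc l) ≡ x → r′ k ≡ r′ l
      go (suc m) q = ≡.trans (r′-suc (≡.trans e q)) (≡.sym (r′-suc q))
      go zero    q = Finₚ.suc-injective (≡.trans (≡.sym (r′-zero (≡.trans e q))) (r′-zero q))

    r-contract : ∀ k → r (suc (contract σ k)) ≡ r (suc k)
    r-contract k = go (σ (suc k)) refl
      where
      go : ∀ x → σ (suc k) ≡ x → r (suc (contract σ k)) ≡ r (suc k)
      go (suc m) q = ≡.trans (cong (r ∘ suc) (contract-suc {σ} q)) (≡.trans (cong r (≡.sym q)) (r-σ cl (suc k)))
      go zero    q = ≡.trans (cong r (≡.sym (contract-zero i q))) (≡.trans (r-σ cl zero)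
                       (≡.trans (cong r (≡.sym q)) (r-σ cl (suc k))))

    r-r′ : ∀ k → r (suc (r′ k)) ≡ r (suc k)
    r-r′ k = go (r (suc k)) refl
      where
      go : ∀ x → r (suc k) ≡ x → r (suc (r′ k)) ≡ r (suc k)
      go (suc m) q = ≡.trans (cong (r ∘ suc) (r′-suc q)) (≡.trans (cong r (≡.sym q)) (r-idem cl (suc k)))
      go zero    q = ≡.trans (cong r (≡.sym (r′-zero q))) (≡.trans (r-σ cl zero)
                       (≡.trans (cong r (≡.sym q)) (r-idem cl (suc k))))

    contract-classes : Classes (contract σ) r′
    contract-classes = record
      { r-σ = λ k → r-suc-cong (r-contract k) ; r-idem = λ k → r-suc-cong (r-r′ k) ; connected = conn }
      where
      conn : (g : Fin n → Bool) → (∀ k → g (contract σ k) ≡ g k) → ∀ k → g (r′ k) ≡ g k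
      conn g inv k = ≡.trans (≡.sym (at-r (r (suc k)) refl)) (connected cl g⁺ g⁺-inv (suc k))
        where
        -- The extension of g gives 0 the value of its successor. If 0 is its own successor any
        -- value is invariant, hence the arbitrary `true`.
        at-zero : Fin (suc n) → Bool
        at-zero zero    = true
        at-zero (suc j) = g j
        g⁺ : Fin (suc n) → Bool
        g⁺ zero    = at-zero (σ zero)
        g⁺ (suc k) = g k
        g⁺-inv : ∀ k → g⁺ (σ k) ≡ g⁺ k
        g⁺-inv zero = go (σ zero) refl
          where
          go : ∀ x → σ zero ≡ x → g⁺ (σ zero) ≡ at-zero (σ zero)
          go zero    q = cong g⁺ q
          go (suc j) q = ≡.trans (cong g⁺ q) (cong at-zero (≡.sym q))
        g⁺-inv (suc k) = go (σ (suc k)) refl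
          where
          go : ∀ x → σ (suc k) ≡ x → g⁺ (σ (suc k)) ≡ g k
          go (suc m) q = ≡.trans (cong g⁺ q) (≡.trans (cong g (≡.sym (contract-suc {σ} q))) (inv k))
          go zero    q = ≡.trans (cong g⁺ q) (≡.trans (cong at-zero (contract-zero i q)) (inv k))
        at-r : ∀ x → r (suc k) ≡ x → g⁺ (r (suc k)) ≡ g (r′ k)
        at-r (suc m) q = ≡.trans (cong g⁺ q) (cong g (≡.sym (r′-suc q)))
        at-r zero    q = ≡.trans (cong g⁺ q) (cong at-zero (r′-zero q))

    roots roots′ : ℕ
    roots  = countF (λ k → r k ==F k)
    roots′ = countF (λ k → r′ k ==F k)

    root-suc : ∀ {k} → r (suc k) ≢ zero → (r (suc k) ==F suc k) ≡ (r′ k ==F k)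
    root-suc {k} ≢0 with r (suc k) in q
    ... | zero  = contradiction refl ≢0
    ... | suc m = ==F-suc m k

    roots-fixed : σ zero ≡ zero → roots ≡ suc roots′
    roots-fixed σ0 = cong₂ ℕ._+_ (cong (λ b → if b then 1 else 0) (≡⇒==F r0))
        (countF-cong λ k → root-suc (fixed⇒r-suc≢0 σ0 k))
      where
      r0 : r zero ≡ zero
      r0 = ==F⇒≡ (fixed⇒own-class σ0 zero)

    -- A cycle that loses 0 but retains its successor j still has one representative: the old one,
    -- or j if the old one was 0.
    roots-moved : ∀ {j} → σ zero ≡ suc j → roots ≡ roots′
    roots-moved {j} σ0 = go (r zero) refl
      where
      go : ∀ x → r zero ≡ x → roots ≡ roots′
      go (suc m) q = cong₂ ℕ._+_ (cong (λ b → if b then 1 else 0) (≢⇒==F (λ e → contradiction (≡.trans (≡.sym e) q) λ ())))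
        (countF-cong λ k → root-suc λ p → contradiction
          (≡.trans (≡.sym p) (≡.trans (≡.sym (r-idem cl (suc k))) (≡.trans (cong r p) q))) λ ())
      go zero q = ≡.trans (cong₂ ℕ._+_ (cong (λ b → if b then 1 else 0) (≡⇒==F q)) (countF-cong same))
                          (≡.sym (countF-remove {p = λ k → r′ k ==F k} j (≡⇒==F r′j)))
        where
        rj : r (suc j) ≡ zero
        rj = ≡.trans (cong r (≡.sym σ0)) (≡.trans (r-σ cl zero) q)
        r′j : r′ j ≡ j
        r′j = Finₚ.suc-injective (≡.trans (≡.sym (r′-zero rj)) σ0)
        same : ∀ k → (r (suc k) ==F suc k) ≡ ((λ k → r′ k ==F k) ∖ j) k
        same k = ⇔⇒≡ to from
          where
          to : (r (suc k) ==F suc k) ≡ true → ((λ k → r′ k ==F k) ∖ j) k ≡ true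
          to e = ∖⁺ {p = λ k → r′ k ==F k} (≡⇒==F (r′-suc (==F⇒≡ e)))
                   λ { refl → contradiction (≡.trans (≡.sym (==F⇒≡ e)) rj) λ () }
          from : ((λ k → r′ k ==F k) ∖ j) k ≡ true → (r (suc k) ==F suc k) ≡ true
          from e with p , k≢j ← ∖⁻ {p = λ k → r′ k ==F k} e = ≡.trans (root-suc λ z → k≢j
            (Finₚ.suc-injective (≡.trans (cong suc (≡.sym (==F⇒≡ p))) (≡.trans (≡.sym (r′-zero z)) σ0)))) p

-- Finite sums and products, and enumerations

module Determinant {c ℓ : Level} (R : CommutativeRing c ℓ) where
  open CommutativeRing R hiding (refl; zero)
  open RingDefs R
  open RingProperties ring
  open SemiringSolver commutativeSemiring using (solve; _:+_; _:*_; _:=_)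
  open SetoidReasoning setoid
  open CommutativeRing R public using () renaming (refl to ≈-refl)

  infixr 6 _▸_
  _▸_ : Bool → Carrier → Carrier
  b ▸ x = if b then x else 0#

  ▸-cong : ∀ b {x y} → (b ≡ true → x ≈ y) → b ▸ x ≈ b ▸ y
  ▸-cong true  f = f refl
  ▸-cong false f = ≈-refl

  ▸-zero : ∀ {b} x → (b ≡ true → x ≈ 0#) → b ▸ x ≈ 0#
  ▸-zero {true}  x f = f refl
  ▸-zero {false} x f = ≈-refl

  ▸-*ʳ : ∀ b x y → x * (b ▸ y) ≈ b ▸ (x * y)
  ▸-*ʳ true  x y = ≈-refl
  ▸-*ʳ false x y = zeroʳ x

  sumF-cong : ∀ {n} {f g : Fin n → Carrier} → (∀ i → f i ≈ g i) → sumF f ≈ sumF g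
  sumF-cong {zero}  e = ≈-refl
  sumF-cong {suc n} e = +-cong (e zero) (sumF-cong (e ∘ suc))

  sumF-zero : ∀ {n} {f : Fin n → Carrier} → (∀ i → f i ≈ 0#) → sumF f ≈ 0#
  sumF-zero {zero}  e = ≈-refl
  sumF-zero {suc n} e = trans (+-cong (e zero) (sumF-zero (e ∘ suc))) (+-identityˡ 0#)

  sumF-+ : ∀ {n} (f g : Fin n → Carrier) → sumF (λ i → f i + g i) ≈ sumF f + sumF g
  sumF-+ {zero}  f g = sym (+-identityˡ 0#)
  sumF-+ {suc n} f g = trans (+-congˡ (sumF-+ (f ∘ suc) (g ∘ suc)))
    (solve 4 (λ a b c d → (a :+ b) :+ (c :+ d) := (a :+ c) :+ (b :+ d)) ≈-refl _ _ _ _)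

  sumF-*ˡ : ∀ {n} x (f : Fin n → Carrier) → x * sumF f ≈ sumF (λ i → x * f i)
  sumF-*ˡ {zero}  x f = zeroʳ x
  sumF-*ˡ {suc n} x f = trans (distribˡ x _ _) (+-congˡ (sumF-*ˡ x (f ∘ suc)))

  sumF-*ʳ : ∀ {n} x (f : Fin n → Carrier) → sumF f * x ≈ sumF (λ i → f i * x)
  sumF-*ʳ x f = trans (*-comm _ x) (trans (sumF-*ˡ x f) (sumF-cong λ i → *-comm x (f i)))

  sumF-neg : ∀ {n} (f : Fin n → Carrier) → sumF (λ i → - f i) ≈ - sumF f
  sumF-neg f = trans (sumF-cong λ i → sym (-1*x≈-x (f i))) (trans (sym (sumF-*ˡ (- 1#) f)) (-1*x≈-x _))

  sumF-δ : ∀ {n} (p : Fin n → Bool) a (f : Fin n → Carrier) → p a ≡ true → (∀ x → p x ≡ true → x ≡ a) →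
           sumF (λ x → p x ▸ f x) ≈ f a
  sumF-δ p zero f pa uniq = trans
    (+-cong (reflexive (cong (_▸ f zero) pa)) (sumF-zero λ i → ▸-zero _ λ e → contradiction (uniq (suc i) e) λ ()))
    (+-identityʳ _)
  sumF-δ p (suc a) f pa uniq = trans
    (+-cong (▸-zero (f zero) λ e → contradiction (uniq zero e) λ ())
            (sumF-δ (p ∘ suc) a (f ∘ suc) pa λ x e → Finₚ.suc-injective (uniq (suc x) e)))
    (+-identityˡ _)

  prodF-cong : ∀ {n} {f g : Fin n → Carrier} → (∀ i → f i ≈ g i) → prodF f ≈ prodF g
  prodF-cong {zero}  e = ≈-refl
  prodF-cong {suc n} e = *-cong (e zero) (prodF-cong (e ∘ suc))

  prodF-one : ∀ {n} {f : Fin n → Carrier} → (∀ i → f i ≈ 1#) → prodF f ≈ 1#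
  prodF-one {zero}  e = ≈-refl
  prodF-one {suc n} e = trans (*-cong (e zero) (prodF-one (e ∘ suc))) (*-identityˡ 1#)

  prodF-* : ∀ {n} (f g : Fin n → Carrier) → prodF (λ i → f i * g i) ≈ prodF f * prodF g
  prodF-* {zero}  f g = sym (*-identityˡ 1#)
  prodF-* {suc n} f g = trans (*-congˡ (prodF-* (f ∘ suc) (g ∘ suc)))
    (solve 4 (λ a b c d → (a :* b) :* (c :* d) := (a :* c) :* (b :* d)) ≈-refl _ _ _ _)

  prodF-zero : ∀ {n} {f : Fin n → Carrier} i → f i ≈ 0# → prodF f ≈ 0#
  prodF-zero zero    e = trans (*-congʳ e) (zeroˡ _)
  prodF-zero (suc i) e = trans (*-congˡ (prodF-zero i e)) (zeroʳ _)

  prodF-single : ∀ {n} {f : Fin n → Carrier} a → (∀ i → i ≢ a → f i ≈ 1#) → prodF f ≈ f a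
  prodF-single zero    e = trans (*-congˡ (prodF-one λ i → e (suc i) λ ())) (*-identityʳ _)
  prodF-single (suc a) e = trans (*-cong (e zero λ ()) (prodF-single a λ i i≢a → e (suc i) (i≢a ∘ Finₚ.suc-injective))) (*-identityˡ _)

  prodF-swap : ∀ {m n} (f : Fin m → Fin n → Carrier) →
               prodF (λ i → prodF (f i)) ≈ prodF (λ j → prodF (λ i → f i j))
  prodF-swap {zero} {n} f = sym (prodF-one {n} {f = λ _ → 1#} λ _ → ≈-refl)
  prodF-swap {suc m} {n} f = trans (*-congˡ (prodF-swap (f ∘ suc))) (sym (prodF-* (f zero) _))

  prodF-permute : ∀ {n} {σ τ : Fin n → Fin n} → Inverses σ τ → (f : Fin n → Carrier) →
                  prodF (f ∘ σ) ≈ prodF f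
  prodF-permute {n} {σ} {τ} i f = begin
    prodF (f ∘ σ) ≡⟨ as-sum (f ∘ σ) ⟩
    sum (f ∘ σ)   ≈⟨ sum-permute f (permutation σ τ (στ i) (τσ i)) ⟨
    sum f         ≡⟨ as-sum f ⟨
    prodF f       ∎
    where
    open MonoidSum *-commutativeMonoid using (sum; sum-permute)
    as-sum : ∀ {n} (f : Fin n → Carrier) → prodF f ≡ sum f
    as-sum {zero}  f = refl
    as-sum {suc n} f = cong (f zero *_) (as-sum (f ∘ suc))

  S : ∀ {a} {A : Set a} → List A → (A → Carrier) → Carrier
  S xs f = sumL (map f xs)

  S-cong : ∀ {a} {A : Set a} (xs : List A) {f g : A → Carrier} → (∀ x → f x ≈ g x) → S xs f ≈ S xs g
  S-cong []       e = ≈-refl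
  S-cong (x ∷ xs) e = +-cong (e x) (S-cong xs e)

  S-zero : ∀ {a} {A : Set a} (xs : List A) {f : A → Carrier} → (∀ x → f x ≈ 0#) → S xs f ≈ 0#
  S-zero []       e = ≈-refl
  S-zero (x ∷ xs) e = trans (+-cong (e x) (S-zero xs e)) (+-identityˡ 0#)

  S-+ : ∀ {a} {A : Set a} (xs : List A) (f g : A → Carrier) → S xs (λ x → f x + g x) ≈ S xs f + S xs g
  S-+ []       f g = sym (+-identityˡ 0#)
  S-+ (x ∷ xs) f g = trans (+-congˡ (S-+ xs f g))
    (solve 4 (λ a b c d → (a :+ b) :+ (c :+ d) := (a :+ c) :+ (b :+ d)) ≈-refl _ _ _ _)

  S-*ˡ : ∀ {a} {A : Set a} (xs : List A) y (f : A → Carrier) → y * S xs f ≈ S xs (λ x → y * f x)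
  S-*ˡ []       y f = zeroʳ y
  S-*ˡ (x ∷ xs) y f = trans (distribˡ y _ _) (+-congˡ (S-*ˡ xs y f))

  S-*ʳ : ∀ {a} {A : Set a} (xs : List A) y (f : A → Carrier) → S xs f * y ≈ S xs (λ x → f x * y)
  S-*ʳ xs y f = trans (*-comm _ y) (trans (S-*ˡ xs y f) (S-cong xs λ x → *-comm y (f x)))

  S-swap : ∀ {a b} {A : Set a} {B : Set b} (xs : List A) (ys : List B) (f : A → B → Carrier) →
           S xs (λ x → S ys (f x)) ≈ S ys (λ y → S xs (λ x → f x y))
  S-swap []       ys f = sym (S-zero ys λ _ → ≈-refl)
  S-swap (x ∷ xs) ys f = trans (+-congˡ (S-swap xs ys f)) (sym (S-+ ys (f x) _))

  S-sumF-swap : ∀ {a} {A : Set a} (xs : List A) {n} (f : A → Fin n → Carrier) →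
                S xs (λ x → sumF (f x)) ≈ sumF (λ i → S xs (λ x → f x i))
  S-sumF-swap []       {n} f = sym (sumF-zero {n} {f = λ _ → 0#} λ _ → ≈-refl)
  S-sumF-swap (x ∷ xs) f = trans (+-congˡ (S-sumF-swap xs f)) (sym (sumF-+ (f x) _))

  S-++ : ∀ {a} {A : Set a} (xs ys : List A) (f : A → Carrier) → S (xs ++ ys) f ≈ S xs f + S ys f
  S-++ []       ys f = sym (+-identityˡ _)
  S-++ (x ∷ xs) ys f = trans (+-congˡ (S-++ xs ys f)) (sym (+-assoc _ _ _))

  S-map : ∀ {a b} {A : Set a} {B : Set b} (g : A → B) xs (f : B → Carrier) → S (map g xs) f ≡ S xs (f ∘ g)
  S-map g xs f = cong sumL (≡.sym (Listₚ.map-∘ xs))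

  S-concatMap : ∀ {a b} {A : Set a} {B : Set b} (g : A → List B) xs (f : B → Carrier) →
                S (concatMap g xs) f ≈ S xs (λ x → S (g x) f)
  S-concatMap g []       f = ≈-refl
  S-concatMap g (x ∷ xs) f = trans (S-++ (g x) _ f) (+-congˡ (S-concatMap g xs f))

  S-filter : ∀ {a} {A : Set a} (p : A → Bool) xs (f : A → Carrier) →
             S (filter (λ x → Data.Bool.T? (p x)) xs) f ≈ S xs (λ x → p x ▸ f x)
  S-filter p []       f = ≈-refl
  S-filter p (x ∷ xs) f with p x
  ... | true  = +-congˡ (S-filter p xs f)
  ... | false = trans (S-filter p xs f) (sym (+-identityˡ _))

  S-allFin : ∀ {n} (f : Fin n → Carrier) → S (allFin n) f ≈ sumF f
  S-allFin {n} f = reflexive (≡.trans (cong sumL (Listₚ.map-tabulate id f)) (go f))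
    where
    go : ∀ {n} (f : Fin n → Carrier) → sumL (List.tabulate f) ≡ sumF f
    go {zero}  f = refl
    go {suc n} f = cong (f zero +_) (go (f ∘ suc))

  S-allVecOf : ∀ {A : Set} (xs : List A) m (f : Vec A (suc m) → Carrier) →
               S (allVecOf xs (suc m)) f ≈ S (allVecOf xs m) (λ v → S xs (λ x → f (x ∷ v)))
  S-allVecOf xs m f = trans (S-concatMap (λ v → map (_∷ v) xs) (allVecOf xs m) f)
    (S-cong (allVecOf xs m) λ v → reflexive (S-map (_∷ v) xs f))

  -- Every element occurs exactly once, expressed through sums of indicator functions.
  Enumerates : ∀ {A : Set} → List A → Set (c ⊔ ℓ)
  Enumerates {A} xs = ∀ (p : A → Bool) a (f : A → Carrier) → p a ≡ true → (∀ x → p x ≡ true → x ≡ a) →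
                      S xs (λ x → p x ▸ f x) ≈ f a

  allFin-enumerates : ∀ n → Enumerates (allFin n)
  allFin-enumerates n p a f pa uniq = trans (S-allFin (λ x → p x ▸ f x)) (sumF-δ p a f pa uniq)

  bool-enumerates : Enumerates (false ∷ true ∷ [])
  bool-enumerates p false f pa uniq = trans (+-cong (reflexive (cong (_▸ f false) pa))
    (trans (+-identityʳ _) (▸-zero (f true) λ e → contradiction (uniq true e) λ ()))) (+-identityʳ _)
  bool-enumerates p true f pa uniq = trans (+-cong (▸-zero (f false) λ e → contradiction (uniq false e) λ ())
    (trans (+-identityʳ _) (reflexive (cong (_▸ f true) pa)))) (+-identityˡ _)

  allVecOf-enumerates : ∀ {A : Set} {xs : List A} → Enumerates xs → ∀ m → Enumerates (allVecOf xs m)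
  allVecOf-enumerates en zero p [] f pa uniq = trans (+-identityʳ _) (reflexive (cong (_▸ f []) pa))
  allVecOf-enumerates {xs = xs} en (suc m) p (b ∷ w) f pa uniq = trans
    (S-allVecOf xs m (λ v → p v ▸ f v))
    (trans (S-cong (allVecOf xs m) heads)
           (allVecOf-enumerates en m (λ v → p (b ∷ v)) w (λ v → f (b ∷ v)) pa λ v e → Vecₚ.∷-injectiveʳ (uniq _ e)))
    where
    -- For a fixed tail v only the head b can pass the test, so the inner sum collapses to the test
    -- at `b ∷ v`.
    heads : ∀ v → S xs (λ x → p (x ∷ v) ▸ f (x ∷ v)) ≈ p (b ∷ v) ▸ f (b ∷ v)
    heads v with p (b ∷ v) in q
    ... | true  = en (λ x → p (x ∷ v)) b (λ x → f (x ∷ v)) q λ x e → Vecₚ.∷-injectiveˡ (≡.trans (uniq _ e) (≡.sym (uniq _ q)))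
    ... | false = S-zero xs λ x → ▸-zero _ λ e → contradiction
      (≡.trans (≡.sym (≡.trans (cong (λ y → p (y ∷ v)) (≡.sym (Vecₚ.∷-injectiveˡ (uniq _ e)))) e)) q) true≢false

  allBoolVec≡ : ∀ m → allBoolVec m ≡ allVecOf (false ∷ true ∷ []) m
  allBoolVec≡ zero    = refl
  allBoolVec≡ (suc m) = cong (concatMap λ v → (false ∷ v) ∷ (true ∷ v) ∷ []) (allBoolVec≡ m)

  allBoolVec-enumerates : ∀ m → Enumerates (allBoolVec m)
  allBoolVec-enumerates m rewrite allBoolVec≡ m = allVecOf-enumerates bool-enumerates m

  allESet-enumerates : ∀ n → Enumerates (allESet n)
  allESet-enumerates n = allVecOf-enumerates (allBoolVec-enumerates n) n

  -- Change of variables by double counting: each term is spread over the b with b = ψ a, the sums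
  -- are exchanged, and on the subsets P and Q the condition b = ψ a is the same as a = φ b.
  reindex : ∀ {A B : Set} {as : List A} {bs : List B} → Enumerates as → Enumerates bs →
            (∀ (x y : A) → Dec (x ≡ y)) → (∀ (x y : B) → Dec (x ≡ y)) →
            (P : A → Bool) (Q : B → Bool) (φ : B → A) (ψ : A → B) →
            (∀ b → Q b ≡ true → P (φ b) ≡ true) → (∀ a → P a ≡ true → Q (ψ a) ≡ true) →
            (∀ a → P a ≡ true → φ (ψ a) ≡ a) → (∀ b → Q b ≡ true → ψ (φ b) ≡ b) →
            (f : A → Carrier) → S as (λ a → P a ▸ f a) ≈ S bs (λ b → Q b ▸ f (φ b))
  reindex {as = as} {bs} enA enB _≟A_ _≟B_ P Q φ ψ Pφ Qψ φψ ψφ f = begin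
    S as (λ a → P a ▸ f a)
      ≈⟨ S-cong as (λ a → enB (λ b → ⌊ b ≟B ψ a ⌋) (ψ a) (λ _ → P a ▸ f a) (⌊⌋-true⁺ refl) (λ b → ⌊⌋-true⁻)) ⟨
    S as (λ a → S bs (λ b → ⌊ b ≟B ψ a ⌋ ▸ P a ▸ f a))
      ≈⟨ S-swap as bs _ ⟩
    S bs (λ b → S as (λ a → ⌊ b ≟B ψ a ⌋ ▸ P a ▸ f a))
      ≈⟨ S-cong bs (λ b → trans (S-cong as (exchange b))
           (enA (λ a → ⌊ a ≟A φ b ⌋) (φ b) (λ a → Q b ▸ f a) (⌊⌋-true⁺ refl) (λ a → ⌊⌋-true⁻))) ⟩
    S bs (λ b → Q b ▸ f (φ b)) ∎
    where
    exchange : ∀ b a → ⌊ b ≟B ψ a ⌋ ▸ P a ▸ f a ≈ ⌊ a ≟A φ b ⌋ ▸ Q b ▸ f a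
    exchange b a with b ≟B ψ a | P a in p | a ≟A φ b | Q b in q
    ... | yes e | true  | yes e′ | true  = ≈-refl
    ... | yes e | true  | yes e′ | false = contradiction (≡.trans (≡.sym (≡.trans (cong Q e) (Qψ a p))) q) true≢false
    ... | yes e | true  | no ¬e  | _     = contradiction (≡.trans (≡.sym (φψ a p)) (cong φ (≡.sym e))) ¬e
    ... | yes e | false | yes e′ | true  = contradiction (≡.trans (≡.sym (≡.trans (cong P e′) (Pφ b q))) p) true≢false
    ... | yes e | false | yes e′ | false = ≈-refl
    ... | yes e | false | no ¬e  | _     = ≈-refl
    ... | no ¬e | _     | yes e′ | true  = contradiction (≡.trans (≡.sym (ψφ b q)) (cong ψ (≡.sym e′))) ¬e
    ... | no ¬e | _     | yes e′ | false = ≈-refl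
    ... | no ¬e | _     | no _   | _     = ≈-refl

  -- General distributivity. Applied to a two-element list, it turns independent decisions at the
  -- vertices into a product of two-term sums.
  prodF-sum : ∀ {A : Set} (xs : List A) {m} (t : Fin m → A → Carrier) →
              S (allVecOf xs m) (λ v → prodF (λ k → t k (lookup v k))) ≈ prodF (λ k → S xs (t k))
  prodF-sum xs {zero}  t = +-identityʳ _
  prodF-sum xs {suc m} t = begin
    S (allVecOf xs (suc m)) (λ v → prodF (λ k → t k (lookup v k)))
      ≈⟨ S-allVecOf xs m _ ⟩
    S (allVecOf xs m) (λ v → S xs (λ x → t zero x * prodF (λ k → t (suc k) (lookup v k))))
      ≈⟨ S-cong (allVecOf xs m) (λ v → S-*ʳ xs _ (t zero)) ⟨
    S (allVecOf xs m) (λ v → S xs (t zero) * prodF (λ k → t (suc k) (lookup v k)))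
      ≈⟨ S-*ˡ (allVecOf xs m) _ _ ⟨
    S xs (t zero) * S (allVecOf xs m) (λ v → prodF (λ k → t (suc k) (lookup v k)))
      ≈⟨ *-congˡ (prodF-sum xs (t ∘ suc)) ⟩
    prodF (λ k → S xs (t k)) ∎

  -- Leibniz expansion, row exchange and the sign of a permutation

  Matrix : ℕ → Set c
  Matrix n = Fin n → Fin n → Carrier

  det-cong : ∀ {n} {A B : Matrix n} → (∀ r s → A r s ≈ B r s) → det A ≈ det B
  det-cong {zero}  e = ≈-refl
  det-cong {suc n} e = sumF-cong λ j → *-congˡ {sgn (toℕ j)} (*-cong (e zero j) (det-cong λ r s → e (suc r) (punchIn j s)))

  permMatrix : ∀ {n N} → (Fin n → Fin N) → (Fin n → Fin N) → Matrix n
  permMatrix ρ σ r s = (σ r ==F ρ s) ▸ 1#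

  -- The recursion of `det` deletes columns, so the induction must allow an arbitrary selection ρ of
  -- columns. Here σ ranges over all maps from rows to columns, and evaluating the coefficient is
  -- postponed by leaving it as a determinant.
  leibniz : ∀ {n N} (A : Fin n → Fin N → Carrier) (ρ : Fin n → Fin N) →
            det (λ r s → A r (ρ s)) ≈
            S (allVecOf (allFin N) n) (λ σ → det (permMatrix ρ (lookup σ)) * prodF (λ r → A r (lookup σ r)))
  leibniz {zero}  A ρ = sym (trans (+-identityʳ _) (*-identityʳ _))
  leibniz {suc n} {N} A ρ = begin
    sumF F₁
      ≈⟨ sumF-cong {f = F₁} {F₂} (λ s → *-congˡ {sgn (toℕ s)} (*-congˡ {A zero (ρ s)} (leibniz (A ∘ suc) (ρ ∘ punchIn s)))) ⟩
    sumF F₂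
      ≈⟨ sumF-cong {f = F₂} {λ s → S V (F₃ s)} (λ s →
           trans (*-congˡ {sgn (toℕ s)} (S-*ˡ V (A zero (ρ s)) (λ σ → D s σ * Π σ))) (S-*ˡ V (sgn (toℕ s)) _)) ⟩
    sumF (λ s → S V (F₃ s))
      ≈⟨ S-sumF-swap V (λ σ s → F₃ s σ) ⟨
    S V (λ σ → sumF (λ s → F₃ s σ))
      ≈⟨ S-cong V row ⟨
    S V (λ σ → S (allFin N) (λ j → sumF (λ s → sgn (toℕ s) * (((j ==F ρ s) ▸ 1#) * D s σ)) * (A zero j * Π σ)))
      ≈⟨ S-allVecOf (allFin N) n _ ⟨
    S (allVecOf (allFin N) (suc n)) (λ σ → det (permMatrix ρ (lookup σ)) * prodF (λ r → A r (lookup σ r))) ∎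
    where
    V = allVecOf (allFin N) n
    D : Fin (suc n) → Vec (Fin N) n → Carrier
    D s σ = det (permMatrix (ρ ∘ punchIn s) (lookup σ))
    Π : Vec (Fin N) n → Carrier
    Π σ = prodF (λ r → A (suc r) (lookup σ r))
    F₁ F₂ : Fin (suc n) → Carrier
    F₁ s = sgn (toℕ s) * (A zero (ρ s) * det (λ r t → A (suc r) (ρ (punchIn s t))))
    F₂ s = sgn (toℕ s) * (A zero (ρ s) * S V (λ σ → D s σ * Π σ))
    F₃ : Fin (suc n) → Vec (Fin N) n → Carrier
    F₃ s σ = sgn (toℕ s) * (A zero (ρ s) * (D s σ * Π σ))
    entry : ∀ σ j s → (sgn (toℕ s) * (((j ==F ρ s) ▸ 1#) * D s σ)) * (A zero j * Π σ) ≈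
                      (j ==F ρ s) ▸ (sgn (toℕ s) * (A zero j * (D s σ * Π σ)))
    entry σ j s with j ==F ρ s
    ... | true  = trans (*-congʳ (*-congˡ {sgn (toℕ s)} (*-identityˡ _)))
      (solve 4 (λ e d a p → (e :* d) :* (a :* p) := e :* (a :* (d :* p))) ≈-refl _ _ _ _)
    ... | false = trans (*-congʳ (trans (*-congˡ {sgn (toℕ s)} (zeroˡ _)) (zeroʳ _))) (zeroˡ _)
    -- Unfolding `det` along the first row turns the coefficient of `j ∷ σ` into the inner
    -- alternating sum; summation over j then leaves only j = ρ s for each s.
    row : ∀ σ → S (allFin N) (λ j → sumF (λ s → sgn (toℕ s) * (((j ==F ρ s) ▸ 1#) * D s σ)) * (A zero j * Π σ)) ≈
                sumF (λ s → F₃ s σ)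
    row σ = begin
      S (allFin N) (λ j → sumF (λ s → G j s) * (A zero j * Π σ))
        ≈⟨ S-cong (allFin N) (λ j → trans (sumF-*ʳ (A zero j * Π σ) (G j)) (sumF-cong {f = λ s → G j s * (A zero j * Π σ)} {H j} (entry σ j))) ⟩
      S (allFin N) (λ j → sumF (H j))
        ≈⟨ S-sumF-swap (allFin N) H ⟩
      sumF (λ s → S (allFin N) (λ j → H j s))
        ≈⟨ sumF-cong {f = λ s → S (allFin N) (λ j → H j s)} {λ s → F₃ s σ} (λ s → allFin-enumerates N (_==F ρ s) (ρ s)
             (λ j → sgn (toℕ s) * (A zero j * (D s σ * Π σ))) (≡⇒==F refl) (λ j → ==F⇒≡)) ⟩
      sumF (λ s → F₃ s σ) ∎
      where
      G H : Fin N → Fin (suc n) → Carrier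
      G j s = sgn (toℕ s) * (((j ==F ρ s) ▸ 1#) * D s σ)
      H j s = (j ==F ρ s) ▸ (sgn (toℕ s) * (A zero j * (D s σ * Π σ)))

  zero-column : ∀ {n} (A : Matrix n) l → (∀ r → A r l ≈ 0#) → det A ≈ 0#
  zero-column {suc n} A l e = sumF-zero λ j → trans (*-congˡ {sgn (toℕ j)} (term j)) (zeroʳ _)
    where
    term : ∀ j → A zero j * det (λ r s → A (suc r) (punchIn j s)) ≈ 0#
    term j with j Fin.≟ l
    ... | yes refl = trans (*-congʳ (e zero)) (zeroˡ _)
    ... | no j≢l = trans (*-congˡ (zero-column _ (punchOut j≢l) λ r →
      trans (reflexive (cong (A (suc r)) (Finₚ.punchIn-punchOut j≢l))) (e (suc r)))) (zeroʳ _)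

  expand-unit-row : ∀ {n} (A : Matrix (suc n)) → (∀ s → A zero s ≈ (zero ==F s) ▸ 1#) →
                    det A ≈ det (λ r s → A (suc r) (suc s))
  expand-unit-row A e = trans (+-cong
    (trans (*-identityˡ _) (trans (*-congʳ (e zero)) (*-identityˡ _)))
    (sumF-zero λ j → trans (*-congˡ { - sgn (toℕ j)} (trans (*-congʳ (e (suc j))) (zeroˡ _))) (zeroʳ _)))
    (+-identityʳ _)

  -- The Laplace expansion along two rows a and b, with an arbitrary function D of the
  -- selection of the remaining columns in place of the complementary minor.
  twoRows : ∀ {n} → (Fin (suc (suc n)) → Carrier) → (Fin (suc (suc n)) → Carrier) →
            ((Fin n → Fin (suc (suc n))) → Carrier) → Carrier
  twoRows a b D = sumF λ j → sumF λ k →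
    (sgn (toℕ j) * sgn (toℕ k)) * ((a j * b (punchIn j k)) * D (punchIn j ∘ punchIn k))

  keep-zero : ∀ {m n} → (Fin m → Fin n) → Fin (suc m) → Fin (suc n)
  keep-zero f zero    = zero
  keep-zero f (suc i) = suc (f i)

  -- The columns 0 and k + 1 chosen in both orders. If 0 comes first, the other column has position
  -- k among the remaining ones and sign s; if it comes second, the other column has position k + 1
  -- and sign -s.
  negated-pair : ∀ s a b d → (1# * s) * ((a * b) * d) + ((- s) * 1#) * ((b * a) * d) ≈ 0#
  negated-pair s a b d = begin
    (1# * s) * ((a * b) * d) + ((- s) * 1#) * ((b * a) * d)
      ≈⟨ +-cong (*-congʳ (*-identityˡ s)) (*-cong (*-identityʳ _) (*-congʳ (*-comm b a))) ⟩
    s * ((a * b) * d) + (- s) * ((a * b) * d)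
      ≈⟨ distribʳ _ s (- s) ⟨
    (s - s) * ((a * b) * d)
      ≈⟨ *-congʳ (-‿inverseʳ s) ⟩
    0# * ((a * b) * d)
      ≈⟨ zeroˡ _ ⟩
    0# ∎

  -x*-y≈x*y : ∀ x y → (- x) * (- y) ≈ x * y
  -x*-y≈x*y x y = trans (sym (-‿distribˡ-* x (- y))) (trans (-‿cong (sym (-‿distribʳ-* x y))) (-‿involutive _))

  rest : ∀ {n} → (Fin (suc (suc n)) → Carrier) → (Fin (suc (suc n)) → Carrier) →
         ((Fin n → Fin (suc (suc n))) → Carrier) → Fin (suc n) → Fin n → Carrier
  rest a b D j k = (sgn (toℕ (suc j)) * sgn (toℕ (suc k))) *
    ((a (suc j) * b (punchIn (suc j) (suc k))) * D (punchIn (suc j) ∘ punchIn (suc k)))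

  -- For pairs avoiding column 0, both positions drop by one when that column is set aside, so the
  -- two sign changes cancel and `twoRows-swap` in smaller dimension applies. The two lemmas are
  -- mutually recursive, hence the early signature.
  rest-swap : ∀ {n} (D : (Fin n → Fin (suc (suc n))) → Carrier) → (∀ {f g} → f ≗ g → D f ≈ D g) → ∀ a b →
              sumF (λ j → sumF (rest a b D j)) + sumF (λ j → sumF (rest b a D j)) ≈ 0#

  -- An ordered pair of columns cancels against the reversed pair. U collects the pairs with column
  -- 0 in first place, V those with it in second place, W the others; U therefore cancels with V of
  -- the exchanged rows.
  twoRows-swap : ∀ {n} a b (D : (Fin n → Fin (suc (suc n))) → Carrier) → (∀ {f g} → f ≗ g → D f ≈ D g) →
                 twoRows a b D + twoRows b a D ≈ 0#
  twoRows-swap {n} a b D D-cong = begin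
    twoRows a b D + twoRows b a D
      ≈⟨ +-cong (split a b) (split b a) ⟩
    (U a b + (V a b + W a b)) + (U b a + (V b a + W b a))
      ≈⟨ solve 6 (λ u v w u′ v′ w′ → (u :+ (v :+ w)) :+ (u′ :+ (v′ :+ w′)) := (u :+ v′) :+ ((u′ :+ v) :+ (w :+ w′))) ≈-refl _ _ _ _ _ _ ⟩
    (U a b + V b a) + ((U b a + V a b) + (W a b + W b a))
      ≈⟨ +-cong (UV a b) (+-cong (UV b a) (WW a b)) ⟩
    0# + (0# + 0#)
      ≈⟨ trans (+-identityˡ _) (+-identityˡ _) ⟩
    0# ∎
    where
    term : (a b : Fin (suc (suc n)) → Carrier) → Fin (suc (suc n)) → Fin (suc n) → Carrier
    term a b j k = (sgn (toℕ j) * sgn (toℕ k)) * ((a j * b (punchIn j k)) * D (punchIn j ∘ punchIn k))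
    U V W : (a b : Fin (suc (suc n)) → Carrier) → Carrier
    U a b = sumF (term a b zero)
    V a b = sumF (λ j → term a b (suc j) zero)
    W a b = sumF (λ j → sumF (λ k → term a b (suc j) (suc k)))
    split : ∀ a b → twoRows a b D ≈ U a b + (V a b + W a b)
    split a b = +-congˡ (sumF-+ (λ j → term a b (suc j) zero) (λ j → sumF (λ k → term a b (suc j) (suc k))))
    UV : ∀ a b → U a b + V b a ≈ 0#
    UV a b = trans (sym (sumF-+ (term a b zero) (λ j → term b a (suc j) zero)))
      (sumF-zero λ k → negated-pair (sgn (toℕ k)) (a zero) (b (suc k)) (D (suc ∘ punchIn k)))
    WW : ∀ a b → W a b + W b a ≈ 0#
    WW = rest-swap D D-cong

  rest-swap {zero}  D D-cong a b = trans
    (+-cong (sumF-zero {f = λ (_ : Fin 1) → 0#} λ _ → ≈-refl) (sumF-zero {f = λ (_ : Fin 1) → 0#} λ _ → ≈-refl)) (+-identityˡ 0#)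
  rest-swap {suc n} D D-cong a b = trans (+-cong (shift a b) (shift b a))
    (twoRows-swap (a ∘ suc) (b ∘ suc) (D ∘ keep-zero) λ e → D-cong λ { zero → refl ; (suc i) → cong suc (e i) })
    where
    shift : ∀ a b → sumF (λ j → sumF (rest a b D j)) ≈ twoRows (a ∘ suc) (b ∘ suc) (D ∘ keep-zero)
    shift a b = sumF-cong {f = λ j → sumF (rest a b D j)} {λ j → sumF (rest′ j)} λ j →
      sumF-cong {f = rest a b D j} {rest′ j} λ k →
      *-cong (-x*-y≈x*y (sgn (toℕ j)) (sgn (toℕ k)))
             (*-congˡ {a (suc j) * b (punchIn (suc j) (suc k))}
               (D-cong {punchIn (suc j) ∘ punchIn (suc k)} λ { zero → refl ; (suc i) → refl }))
      where
      rest′ : Fin (suc (suc n)) → Fin (suc n) → Carrier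
      rest′ j k = (sgn (toℕ j) * sgn (toℕ k)) *
        ((a (suc j) * b (suc (punchIn j k))) * D (keep-zero (punchIn j ∘ punchIn k)))

  det≈twoRows : ∀ {n} (A : Matrix (suc (suc n))) →
                det A ≈ twoRows (A zero) (A (suc zero)) (λ f → det (λ r s → A (suc (suc r)) (f s)))
  det≈twoRows {n} A = sumF-cong {f = λ j → sgn (toℕ j) * (A zero j * sumF (F j))} {λ j → sumF (G j)} λ j →
    trans (*-congˡ {sgn (toℕ j)} (sumF-*ˡ (A zero j) (F j)))
    (trans (sumF-*ˡ (sgn (toℕ j)) (λ k → A zero j * F j k))
           (sumF-cong {f = λ k → sgn (toℕ j) * (A zero j * F j k)} {G j} λ k →
      solve 5 (λ s a t b d → s :* (a :* (t :* (b :* d))) := (s :* t) :* ((a :* b) :* d)) ≈-refl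
        (sgn (toℕ j)) (A zero j) (sgn (toℕ k)) (A (suc zero) (punchIn j k)) (M j k)))
    where
    M F G : Fin (suc (suc n)) → Fin (suc n) → Carrier
    M j k = det (λ r s → A (suc (suc r)) (punchIn j (punchIn k s)))
    F j k = sgn (toℕ k) * (A (suc zero) (punchIn j k) * M j k)
    G j k = (sgn (toℕ j) * sgn (toℕ k)) * ((A zero j * A (suc zero) (punchIn j k)) * M j k)

  swap-first-rows : ∀ {n} (A B : Matrix (suc (suc n))) →
                    (∀ s → B zero s ≈ A (suc zero) s) → (∀ s → B (suc zero) s ≈ A zero s) →
                    (∀ r s → B (suc (suc r)) s ≈ A (suc (suc r)) s) → det B ≈ - det A
  swap-first-rows A B e₀ e₁ e = begin
    det B
      ≈⟨ det-cong {A = B} {B′} (λ { zero → e₀ ; (suc zero) → e₁ ; (suc (suc r)) → e r }) ⟩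
    det B′
      ≈⟨ det≈twoRows B′ ⟩
    twoRows (A (suc zero)) (A zero) D
      ≈⟨ +-inverseˡ-unique _ _ (twoRows-swap (A (suc zero)) (A zero) D λ e → det-cong λ r s → reflexive (cong (A (suc (suc r))) (e s))) ⟩
    - twoRows (A zero) (A (suc zero)) D
      ≈⟨ -‿cong (det≈twoRows A) ⟨
    - det A ∎
    where
    D = λ f → det (λ r s → A (suc (suc r)) (f s))
    B′ : Matrix (suc (suc _))
    B′ = λ { zero → A (suc zero) ; (suc zero) → A zero ; (suc (suc r)) → A (suc (suc r)) }

  -- The transposition of rows 0 and r + 2 equals (0 1)(1 r+2)(0 1). The middle factor does not move
  -- row 0, so it acts inside the minors, where induction applies; three sign changes amount to one.
  swap-rows : ∀ {n} (r : Fin n) (A B : Matrix (suc n)) →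
              (∀ s → B zero s ≈ A (suc r) s) → (∀ s → B (suc r) s ≈ A zero s) →
              (∀ k → k ≢ r → ∀ s → B (suc k) s ≈ A (suc k) s) → det B ≈ - det A
  swap-rows {suc n} zero A B e₀ e₁ e = swap-first-rows A B e₀ e₁ λ r → e (suc r) λ ()
  swap-rows {suc n} (suc r) A B e₀ e₁ e = begin
    det B         ≈⟨ swap-first-rows A₂ B e₀ (e zero λ ()) (λ _ _ → ≈-refl) ⟩
    - det A₂      ≈⟨ -‿cong minors ⟩
    - - det A₁    ≈⟨ -‿cong (-‿cong (swap-first-rows A A₁ (λ _ → ≈-refl) (λ _ → ≈-refl) (λ _ _ → ≈-refl))) ⟩
    - - - det A   ≈⟨ -‿involutive _ ⟩
    - det A       ∎
    where
    A₁ A₂ : Matrix (suc (suc n))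
    A₁ zero          = A (suc zero)
    A₁ (suc zero)    = A zero
    A₁ (suc (suc k)) = A (suc (suc k))
    A₂ zero          = A (suc zero)
    A₂ (suc zero)    = A (suc (suc r))
    A₂ (suc (suc k)) = B (suc (suc k))
    minors : det A₂ ≈ - det A₁
    minors = trans (sumF-cong {f = λ j → sgn (toℕ j) * (A (suc zero) j * det (minor A₂ j))} { -_ ∘ F } λ j →
      trans (*-congˡ {sgn (toℕ j)} (trans
        (*-congˡ {A (suc zero) j} (swap-rows r (minor A₁ j) (minor A₂ j)
          (λ s → ≈-refl) (λ s → e₁ (punchIn j s)) (λ k k≢r s → e (suc k) (k≢r ∘ Finₚ.suc-injective) (punchIn j s))))
        (sym (-‿distribʳ-* (A (suc zero) j) _)))) (sym (-‿distribʳ-* (sgn (toℕ j)) _)))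
      (sumF-neg F)
      where
      minor : Matrix (suc (suc n)) → Fin (suc (suc n)) → Matrix (suc n)
      minor A j p s = A (suc p) (punchIn j s)
      F : Fin (suc (suc n)) → Carrier
      F j = sgn (toℕ j) * (A (suc zero) j * det (minor A₁ j))

  sgn-suc-suc : ∀ m → sgn (suc (suc m)) ≈ sgn m
  sgn-suc-suc m = -‿involutive _

  -- The sign (-1)^(n - c) of a permutation with c cycles, written without truncated subtraction.
  det-permMatrix : ∀ {n} {σ τ r : Fin n → Fin n} → Inverses σ τ → Classes σ r →
                   det (permMatrix id σ) ≈ sgn (n ℕ.+ countF (λ k → r k ==F k))
  det-permMatrix {zero} i cl = ≈-refl
  det-permMatrix {suc n} {σ} {τ} {r} i cl = go (σ zero) refl (τ zero) refl
    where
    open Contract i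
    σ′ = contract σ
    c′ = roots′ cl
    minor≈ : det (permMatrix id σ′) ≈ sgn (n ℕ.+ c′)
    minor≈ = det-permMatrix contract-inverses (contract-classes cl)
    -- The matrix of the permutation that fixes 0 and acts on the other vertices as `σ′`.
    contracted : Matrix (suc n)
    contracted zero    s = (zero ==F s) ▸ 1#
    contracted (suc k) s = (suc (σ′ k) ==F s) ▸ 1#
    det-contracted : det contracted ≈ sgn (n ℕ.+ c′)
    det-contracted = trans (expand-unit-row contracted λ _ → ≈-refl)
      (trans (det-cong λ k s → reflexive (cong (_▸ 1#) (==F-suc (σ′ k) s))) minor≈)
    unmoved : ∀ k → σ (suc k) ≢ zero → σ (suc k) ≡ suc (σ′ k)
    unmoved k ≢0 = aux (σ (suc k)) refl
      where
      aux : ∀ x → σ (suc k) ≡ x → σ (suc k) ≡ suc (σ′ k)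
      aux zero    q = contradiction q ≢0
      aux (suc m) q = ≡.trans q (cong suc (≡.sym (contract-suc {σ} q)))
    entry : ∀ {x y} → x ≡ y → ∀ (s : Fin (suc n)) → (x ==F s) ▸ 1# ≈ (y ==F s) ▸ 1#
    entry q s = reflexive (cong (λ x → (x ==F s) ▸ 1#) q)
    go : ∀ x → σ zero ≡ x → ∀ y → τ zero ≡ y → det (permMatrix id σ) ≈ sgn (suc n ℕ.+ roots cl)
    go zero p _ _ = begin
      det (permMatrix id σ)  ≈⟨ det-cong {A = permMatrix id σ} {contracted} (λ { zero → entry p ; (suc k) → entry (unmoved k λ q →
                                  contradiction (σ-injective i (≡.trans p (≡.sym q))) λ ()) }) ⟩
      det contracted         ≈⟨ det-contracted ⟩
      -- Restoring a fixed point raises both the order and the number of cycles by one, so the sign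
      -- changes twice.
      sgn (n ℕ.+ c′)         ≈⟨ sgn-suc-suc (n ℕ.+ c′) ⟨
      sgn (suc (suc (n ℕ.+ c′))) ≡⟨ cong (sgn ∘ suc) (≡.sym (ℕₚ.+-suc n c′)) ⟩
      sgn (suc n ℕ.+ suc c′)  ≡⟨ cong (λ c → sgn (suc n ℕ.+ c)) (≡.sym (roots-fixed cl p)) ⟩
      sgn (suc n ℕ.+ roots cl) ∎
    go (suc j) p zero    q = contradiction (≡.trans (≡.sym p) (≡.trans (cong σ (≡.sym q)) (στ i zero))) λ ()
    -- Row k + 1 is the one that σ sends to 0. Exchanging it with row 0 gives `contracted`; the
    -- resulting sign matches an order larger by one with the same number of cycles.
    go (suc j) p (suc k) q = begin
      det (permMatrix id σ)      ≈⟨ -‿involutive _ ⟨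
      - - det (permMatrix id σ)  ≈⟨ -‿cong (swap-rows k (permMatrix id σ) contracted
                                      (entry (≡.sym σk≡0)) (entry (≡.sym (contract-zero i σk≡0)))
                                      (λ l l≢k → entry (≡.sym (unmoved l λ z → l≢k (Finₚ.suc-injective
                                        (σ-injective i (≡.trans z (≡.sym σk≡0)))))))) ⟨
      - det contracted           ≈⟨ -‿cong det-contracted ⟩
      sgn (suc n ℕ.+ c′)         ≡⟨ cong (λ c → sgn (suc n ℕ.+ c)) (≡.sym (roots-moved cl p)) ⟩
      sgn (suc n ℕ.+ roots cl)   ∎
      where
      σk≡0 : σ (suc k) ≡ zero
      σk≡0 = ≡.trans (cong σ (≡.sym q)) (στ i zero)

isCycleRep⁻ : ∀ {n} (E : ESet n) {k} → isCycleRep E k ≡ true → rep E k ≡ k × degE E k ≡ 2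
isCycleRep⁻ E {k} e with r , d ← ∧-true⁻ {isRep E k} e = ==F⇒≡ (≡.trans (≡.sym (isRep≡ E k)) r) , ≡ᵇ-true⁻ d

isCycleRep⁺ : ∀ {n} (E : ESet n) {k} → rep E k ≡ k → degE E k ≡ 2 → isCycleRep E k ≡ true
isCycleRep⁺ E {k} r d = ∧-true⁺ (≡.trans (isRep≡ E k) (≡⇒==F r)) (≡ᵇ-true⁺ d)

Orients-sym : ∀ {n} {E : ESet n} {σ τ} → Symmetric E → Orients E σ τ → Orients E τ σ
Orients-sym s o = record
  { inverse = Inverses-sym (inverse o) ; edge = edge-τ s o ; cover = [ inj₂ , inj₁ ]′ ∘ cover o }

-- Values of mixed cycles in both directions

module CycleValues {c ℓ : Level} (R : CommutativeRing c ℓ) where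
  open CommutativeRing R hiding (refl; zero)
  open RingDefs R
  open RingProperties ring
  open Determinant R
  open SetoidReasoning setoid

  infixr 6 _▹_
  -- The multiplicative counterpart of `▸`: its default 1 restricts a product to a subset.
  _▹_ : Bool → Carrier → Carrier
  b ▹ x = if b then x else 1#

  ▹-cong : ∀ b {x y} → (b ≡ true → x ≈ y) → b ▹ x ≈ b ▹ y
  ▹-cong true  f = f refl
  ▹-cong false f = ≈-refl

  ▹-* : ∀ b x y → (b ▹ x) * (b ▹ y) ≈ b ▹ (x * y)
  ▹-* true  x y = ≈-refl
  ▹-* false x y = *-identityˡ 1#

  ▹-one : ∀ {b x} → (b ≡ true → x ≈ 1#) → b ▹ x ≈ 1#
  ▹-one {true}  f = f refl
  ▹-one {false} f = ≈-refl

  prodF-remove : ∀ {n} (p : Fin n → Bool) (f : Fin n → Carrier) a → p a ≡ true →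
                 prodF (λ v → p v ▹ f v) ≈ f a * prodF (λ v → (p ∖ a) v ▹ f v)
  prodF-remove p f a pa = begin
    prodF (λ v → p v ▹ f v)
      ≈⟨ prodF-cong split ⟩
    prodF (λ v → ((v ==F a) ▹ f v) * ((p ∖ a) v ▹ f v))
      ≈⟨ prodF-* (λ v → (v ==F a) ▹ f v) (λ v → (p ∖ a) v ▹ f v) ⟩
    prodF (λ v → (v ==F a) ▹ f v) * prodF (λ v → (p ∖ a) v ▹ f v)
      ≈⟨ *-congʳ (trans (prodF-single {f = λ v → (v ==F a) ▹ f v} a λ i i≢a → reflexive (cong (_▹ f i) (≢⇒==F i≢a)))
                        (reflexive (cong (_▹ f a) (≡⇒==F {i = a} refl)))) ⟩
    f a * prodF (λ v → (p ∖ a) v ▹ f v) ∎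
    where
    split : ∀ v → p v ▹ f v ≈ ((v ==F a) ▹ f v) * ((p ∖ a) v ▹ f v)
    split v with p v in q | v ==F a in r
    ... | true  | true  = sym (*-identityʳ _)
    ... | true  | false = sym (*-identityˡ _)
    ... | false | false = sym (*-identityˡ _)
    ... | false | true  = contradiction (≡.trans (≡.sym q) (≡.trans (cong p (==F⇒≡ r)) pa)) λ ()

  module _ (ι : Carrier) (ι² : ι * ι ≈ - 1#) where

    pow : ℕ → Carrier
    pow zero    = 1#
    pow (suc m) = ι * pow m

    pow-+ : ∀ a b → pow (a ℕ.+ b) ≈ pow a * pow b
    pow-+ zero    b = sym (*-identityˡ _)
    pow-+ (suc a) b = trans (*-congˡ (pow-+ a b)) (sym (*-assoc ι _ _))

    ι*ι* : ∀ x → ι * (ι * x) ≈ - x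
    ι*ι* x = trans (sym (*-assoc ι ι x)) (trans (*-congʳ ι²) (-1*x≈-x x))

    pow-4+ : ∀ m → pow (4 ℕ.+ m) ≈ pow m
    pow-4+ m = trans (ι*ι* _) (trans (-‿cong (ι*ι* _)) (-‿involutive _))

    pow-*4 : ∀ m → pow (m ℕ.* 4) ≈ 1#
    pow-*4 zero    = ≈-refl
    pow-*4 (suc m) = trans (pow-4+ (m ℕ.* 4)) (pow-*4 m)

    pow-% : ∀ m → pow (m ℕ.% 4) ≈ pow m
    pow-% m = sym (begin
      pow m                                    ≡⟨ cong pow (m≡m%n+[m/n]*n m 4) ⟩
      pow (m ℕ.% 4 ℕ.+ m ℕ./ 4 ℕ.* 4)          ≈⟨ pow-+ (m ℕ.% 4) _ ⟩
      pow (m ℕ.% 4) * pow (m ℕ./ 4 ℕ.* 4)      ≈⟨ *-congˡ (pow-*4 (m ℕ./ 4)) ⟩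
      pow (m ℕ.% 4) * 1#                       ≈⟨ *-identityʳ _ ⟩
      pow (m ℕ.% 4) ∎)

    pow-phase : ∀ κ → isEdge κ ≡ true → pow (phase κ) ≈ kindVal ι κ
    pow-phase undir _ = ≈-refl
    pow-phase out   _ = *-identityʳ ι
    pow-phase inn   _ = trans (ι*ι* _) (-‿cong (*-identityʳ ι))

    kindVal-flip : ∀ κ → isEdge κ ≡ true → kindVal ι κ * kindVal ι (flipK κ) ≈ 1#
    kindVal-flip undir _ = *-identityˡ 1#
    kindVal-flip out   _ = trans (sym (-‿distribʳ-* ι ι)) (trans (-‿cong ι²) (-‿involutive 1#))
    kindVal-flip inn   _ = trans (sym (-‿distribˡ-* ι ι)) (trans (-‿cong ι²) (-‿involutive 1#))

    -- Multiply x by ι^(4p) = 1 and cancel one factor ι^p against x; the exponent p + (p + p) is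
    -- what remains.
    pow*x≈1⇒x≈pow : ∀ p {x} → pow p * x ≈ 1# → x ≈ pow (p ℕ.+ (p ℕ.+ p))
    pow*x≈1⇒x≈pow p {x} e = begin
      x                                        ≈⟨ *-identityʳ x ⟨
      x * 1#                                   ≈⟨ *-congˡ (pow-*4 p) ⟨
      x * pow (p ℕ.* 4)                        ≡⟨ cong (λ q → x * pow q) fourfold ⟩
      x * pow (p ℕ.+ (p ℕ.+ (p ℕ.+ p)))        ≈⟨ *-congˡ (pow-+ p _) ⟩
      x * (pow p * pow (p ℕ.+ (p ℕ.+ p)))      ≈⟨ *-assoc x _ _ ⟨
      (x * pow p) * pow (p ℕ.+ (p ℕ.+ p))      ≈⟨ *-congʳ (trans (*-comm x _) e) ⟩
      1# * pow (p ℕ.+ (p ℕ.+ p))               ≈⟨ *-identityˡ _ ⟩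
      pow (p ℕ.+ (p ℕ.+ p)) ∎
      where
      fourfold : p ℕ.* 4 ≡ p ℕ.+ (p ℕ.+ (p ℕ.+ p))
      fourfold = ≡.trans (ℕₚ.*-comm p 4) (cong (λ q → p ℕ.+ (p ℕ.+ (p ℕ.+ q))) (ℕₚ.+-identityʳ p))

    -- Twice the real part of ι^p.
    trace : ℕ → Carrier
    trace p = ((p ℕ.≡ᵇ 0) ∨ (p ℕ.≡ᵇ 2)) ▸ (sgn (if p ℕ.≡ᵇ 2 then 1 else 0) * (1# + 1#))

    trace-pow : ∀ p → p ℕ.< 4 → pow p + pow (p ℕ.+ (p ℕ.+ p)) ≈ trace p
    trace-pow 0 _ = sym (*-identityˡ _)
    trace-pow 1 _ = trans (+-congˡ (ι*ι* _)) (-‿inverseʳ _)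
    trace-pow 2 _ = begin
      ι * (ι * 1#) + pow 6                ≈⟨ +-cong (ι*ι* 1#) (trans (pow-4+ 2) (ι*ι* 1#)) ⟩
      - 1# + - 1#                         ≈⟨ +-cong (-1*x≈-x 1#) (-1*x≈-x 1#) ⟨
      - 1# * 1# + - 1# * 1#               ≈⟨ distribˡ (- 1#) 1# 1# ⟨
      - 1# * (1# + 1#)                    ∎
    trace-pow 3 _ = trans (+-cong (ι*ι* _) (trans (pow-4+ 5) (pow-4+ 1))) (-‿inverseˡ _)
    trace-pow (suc (suc (suc (suc p)))) (s≤s (s≤s (s≤s (s≤s ()))))

    trace-unique : ∀ {p x y} → p ℕ.< 4 → pow p ≈ x → x * y ≈ 1# → x + y ≈ trace p
    trace-unique {p} {x} {y} p<4 e xy = trans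
      (+-cong (sym e) (pow*x≈1⇒x≈pow p (trans (*-congʳ e) xy))) (trace-pow p p<4)

    module _ {n} (M : MixedGraph n) {E : ESet n} (edges : ∀ {k l} → Edge E k l → isEdge (kind M k l) ≡ true)
             (s : Symmetric E) where

      h : Fin n → Fin n → Carrier
      h k l = kindVal ι (kind M k l)

      -- The unit factor of the component represented by k, traversed along σ. If k represents no
      -- component the product is empty.
      classVal : (Fin n → Fin n) → Fin n → Carrier
      classVal σ k = prodF λ v → (rep E v ==F k) ▹ h v (σ v)

      h-flip : ∀ {k l} → Edge E k l → h k l * h l k ≈ 1#
      h-flip {k} {l} e = trans (*-congˡ (reflexive (cong (kindVal ι) (skew M k l)))) (kindVal-flip (kind M k l) (edges e))

      -- Reindexing the second product by σ places the factor of an edge traversed backwards next to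
      -- its forward factor, and their product is 1.
      classVal-inverse : ∀ {σ τ} → Orients E σ τ → ∀ k → classVal σ k * classVal τ k ≈ 1#
      classVal-inverse {σ} {τ} o k = begin
        classVal σ k * classVal τ k
          ≈⟨ *-congˡ (prodF-permute (inverse o) (λ v → (rep E v ==F k) ▹ h v (τ v))) ⟨
        classVal σ k * prodF (λ v → (rep E (σ v) ==F k) ▹ h (σ v) (τ (σ v)))
          ≈⟨ prodF-* (λ v → (rep E v ==F k) ▹ h v (σ v)) _ ⟨
        prodF (λ v → ((rep E v ==F k) ▹ h v (σ v)) * ((rep E (σ v) ==F k) ▹ h (σ v) (τ (σ v))))
          ≈⟨ prodF-one (λ v → trans
               (*-congˡ (reflexive (cong₂ (λ r l → (r ==F k) ▹ h (σ v) l) (rep-σ s o v) (τσ (inverse o) v))))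
               (trans (▹-* (rep E v ==F k) _ _) (▹-one {rep E v ==F k} λ _ → h-flip (edge o v)))) ⟩
        1# ∎

      classVal-edge : ∀ {σ τ} → Orients E σ τ → ∀ {k} → rep E k ≡ k → degE E k ≡ 1 → classVal σ k ≈ 1#
      classVal-edge {σ} {τ} o {k} rk d = begin
        classVal σ k
          ≈⟨ prodF-remove cls (λ v → h v (σ v)) k (≡⇒==F rk) ⟩
        h k (σ k) * prodF (λ v → (cls ∖ k) v ▹ h v (σ v))
          ≈⟨ *-congˡ (prodF-remove (cls ∖ k) (λ v → h v (σ v)) (σ k)
               (∖⁺ {p = cls} (≡⇒==F (≡.trans (rep-σ s o k) rk)) σk≢k)) ⟩
        h k (σ k) * (h (σ k) (σ (σ k)) * prodF (λ v → ((cls ∖ k) ∖ σ k) v ▹ h v (σ v)))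
          ≈⟨ *-congˡ (*-cong (reflexive (cong (h (σ k)) σσk)) (prodF-one λ v → ▹-one {((cls ∖ k) ∖ σ k) v}
               λ e → contradiction (outside v e) λ ())) ⟩
        h k (σ k) * (h (σ k) k * 1#)
          ≈⟨ *-congˡ (*-identityʳ _) ⟩
        h k (σ k) * h (σ k) k
          ≈⟨ h-flip (edge o k) ⟩
        1# ∎
        where
        cls : Fin n → Bool
        cls v = rep E v ==F k
        σk≢k : σ k ≢ k
        σk≢k q = isEdge⇒irreflexive M E edges (edge o k) (≡.sym q)
        σσk : σ (σ k) ≡ k
        σσk = ≡.trans (cong σ (degE≡1⇒ s o d)) (στ (inverse o) k)
        -- The set {k, σ k} is closed under σ, so it is the whole component and no third factor
        -- survives.
        V : Fin n → Bool
        V v = (v ==F k) ∨ (v ==F σ k)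
        V-inv : ∀ v → V (σ v) ≡ V v
        V-inv v = ⇔⇒≡
          ([ (λ e → ∨-true⁺ʳ {v ==F k} (≡⇒==F (σ-injective (inverse o) (≡.trans (==F⇒≡ e) (≡.sym σσk)))))
           , (λ e → ∨-true⁺ˡ (≡⇒==F (σ-injective (inverse o) (==F⇒≡ e)))) ]′ ∘ ∨-true⁻ {σ v ==F k})
          ([ (λ e → ∨-true⁺ʳ {σ v ==F k} (≡⇒==F (cong σ (==F⇒≡ e))))
           , (λ e → ∨-true⁺ˡ (≡⇒==F (≡.trans (cong σ (==F⇒≡ e)) σσk))) ]′ ∘ ∨-true⁻ {v ==F k})
        outside : ∀ v → ((cls ∖ k) ∖ σ k) v ≡ true → true ≡ false
        outside v e with p , v≢σk ← ∖⁻ {p = cls ∖ k} e with c , v≢k ← ∖⁻ {p = cls} p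
          with ∨-true⁻ {v ==F k} (≡.trans (≡.sym (invariant⇒rep s o V V-inv v))
                 (≡.trans (cong V (==F⇒≡ c)) (∨-true⁺ˡ {b = k ==F σ k} (≡⇒==F {i = k} refl))))
        ... | inj₁ q = contradiction (==F⇒≡ q) v≢k
        ... | inj₂ q = contradiction (==F⇒≡ q) v≢σk

      -- V is the set of vertices already visited by a walk that started at k and is about to leave prev.
      record Visited (σ : Fin n → Fin n) (k prev : Fin n) (V : Fin n → Bool) : Set where
        field
          backward : ∀ v → V (σ v) ≡ true → σ v ≡ k ⊎ V v ≡ true
          forward  : ∀ v → V v ≡ true → V (σ v) ≡ true ⊎ v ≡ prev
          start∈   : V k ≡ true
          prev∈    : V prev ≡ true
          next∉    : V (σ prev) ≡ false
          ⊆class   : rep E prev ≡ k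
      open Visited

      -- Each step of the walk moves one factor h v (σ v) from the product over unvisited vertices
      -- into the phase. The fuel bound is preserved because every step also enlarges V by one
      -- vertex.
      walkPhase-val : ∀ {σ τ} → Orients E σ τ → ∀ {k} → rep E k ≡ k → degE E k ≡ 2 →
                      ∀ f prev V → Visited σ k prev V → n ℕ.≤ countF V ℕ.+ f →
                      pow (walkPhase M E f k prev (σ prev)) ≈
                      prodF (λ v → ((rep E v ==F k) ∧ not (V v)) ▹ h v (σ v))
      walkPhase-val {σ} {τ} o {k} rk d f prev V vis fuel = go f fuel
        where
        cur = σ prev
        V′ : Fin n → Bool
        V′ v = V v ∨ (v ==F cur)
        V⊆V′∖cur : ∀ v → V v ≡ true → (V′ ∖ cur) v ≡ true
        V⊆V′∖cur v e = ∖⁺ {p = V′} (∨-true⁺ˡ e) λ { refl → true≢false (≡.trans (≡.sym e) (next∉ vis)) }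
        cur∈V′ : V′ cur ≡ true
        cur∈V′ = ∨-true⁺ʳ {V cur} (≡⇒==F refl)
        grows : suc (countF V) ℕ.≤ countF V′
        grows = ℕₚ.≤-trans (s≤s (countF-mono V⊆V′∖cur)) (ℕₚ.≤-reflexive (≡.sym (countF-remove {p = V′} cur cur∈V′)))
        rep-cur : rep E cur ≡ k
        rep-cur = ≡.trans (rep-σ s o prev) (⊆class vis)
        deg-cur : degE E cur ≡ 2
        deg-cur = ≡.trans (≡.sym (invariant⇒rep s o (degE E) (≡.sym ∘ degE-σ s o) cur))
                          (≡.trans (cong (degE E) rep-cur) d)
        σcur≢prev : σ cur ≢ prev
        σcur≢prev q = degE≡2⇒ s o deg-cur (≡.trans q (≡.sym (τσ (inverse o) prev)))
        -- The neighbours of `cur` are `σ cur` and `τ cur`, the latter being `prev`; degree 2 keeps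
        -- them distinct, so excluding `prev` leaves one candidate.
        found : findF (λ x → adjE E cur x ∧ not (x ==F prev)) ≡ just (σ cur)
        found = findF-unique {p = λ x → adjE E cur x ∧ not (x ==F prev)} (σ cur)
          (∖⁺ {p = adjE E cur} (edge o cur) σcur≢prev)
          λ j e → let a , j≢prev = ∖⁻ {p = adjE E cur} e in
            [ id , (λ q → contradiction (≡.trans q (τσ (inverse o) prev)) j≢prev) ]′ (cover o a)
        V′-backward : ∀ v → V′ (σ v) ≡ true → σ v ≡ k ⊎ V v ≡ true
        V′-backward v e with ∨-true⁻ {V (σ v)} e
        ... | inj₁ q = backward vis v q
        ... | inj₂ q = inj₂ (≡.trans (cong V (σ-injective (inverse o) (==F⇒≡ q))) (prev∈ vis))
        V′-forward : ∀ v → V′ v ≡ true → V′ (σ v) ≡ true ⊎ v ≡ cur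
        V′-forward v e with ∨-true⁻ {V v} e
        ... | inj₂ q = inj₂ (==F⇒≡ q)
        ... | inj₁ q with forward vis v q
        ...   | inj₁ r    = inj₁ (∨-true⁺ˡ r)
        ...   | inj₂ refl = inj₁ cur∈V′
        leave : prodF (λ v → ((rep E v ==F k) ∧ not (V v)) ▹ h v (σ v)) ≈
                h cur (σ cur) * prodF (λ v → ((rep E v ==F k) ∧ not (V′ v)) ▹ h v (σ v))
        leave = trans (prodF-remove (λ v → (rep E v ==F k) ∧ not (V v)) (λ v → h v (σ v)) cur
                        (∧-true⁺ (≡⇒==F rep-cur) (not-true⁺ (next∉ vis))))
                      (*-congˡ (prodF-cong λ v → reflexive (cong (_▹ h v (σ v)) (de-morgan (rep E v ==F k) (V v) (v ==F cur)))))
          where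
          de-morgan : ∀ a b c → (a ∧ not b) ∧ not c ≡ a ∧ not (b ∨ c)
          de-morgan false _     _ = refl
          de-morgan true  false _ = refl
          de-morgan true  true  _ = refl
        -- Once the walk closes up at k the visited set is σ-invariant. It contains k, hence the
        -- whole component, and the remaining product is empty.
        finished : σ cur ≡ k → ∀ v → ((rep E v ==F k) ∧ not (V′ v)) ▹ h v (σ v) ≈ 1#
        finished σcur≡k v = ▹-one {(rep E v ==F k) ∧ not (V′ v)} λ e →
          let c , ¬V′ = ∧-true⁻ {rep E v ==F k} e in
          contradiction (≡.trans (≡.sym (≡.trans (≡.sym (invariant⇒rep s o V′ V′-inv v))
            (≡.trans (cong V′ (==F⇒≡ c)) (∨-true⁺ˡ (start∈ vis))))) (not-true⁻ ¬V′)) true≢false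
          where
          V′-inv : ∀ v → V′ (σ v) ≡ V′ v
          V′-inv v = ⇔⇒≡
            (λ e → [ (λ q → ∨-true⁺ʳ {V v} (≡⇒==F (σ-injective (inverse o) (≡.trans q (≡.sym σcur≡k))))) , ∨-true⁺ˡ ]′ (V′-backward v e))
            (λ e → [ id , (λ q → ∨-true⁺ˡ (≡.trans (cong V (≡.trans (cong σ q) σcur≡k)) (start∈ vis))) ]′ (V′-forward v e))
        go : ∀ f → n ℕ.≤ countF V ℕ.+ f → pow (walkPhase M E f k prev cur) ≈
                      prodF (λ v → ((rep E v ==F k) ∧ not (V v)) ▹ h v (σ v))
        -- Without fuel V would contain all n vertices, although `cur` is still outside it.
        go zero fuel = contradiction (ℕₚ.≤-trans grows (countF≤n V′))
          (ℕₚ.≤⇒≯ (ℕₚ.≤-trans fuel (ℕₚ.≤-reflexive (ℕₚ.+-identityʳ _))))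
        go (suc f) fuel rewrite found = trans (pow-+ (phase (kind M cur (σ cur))) _)
          (trans (*-cong (pow-phase _ (edges (edge o cur))) tail) (sym leave))
          where
          tail : pow (if σ cur ==F k then 0 else walkPhase M E f k cur (σ cur)) ≈
                 prodF (λ v → ((rep E v ==F k) ∧ not (V′ v)) ▹ h v (σ v))
          tail with σ cur ==F k in q
          ... | true  = sym (prodF-one (finished (==F⇒≡ q)))
          ... | false = walkPhase-val o rk d f cur V′ (record
            { backward = λ v e → [ inj₁ , inj₂ ∘ ∨-true⁺ˡ ]′ (V′-backward v e)
            ; forward  = V′-forward
            ; start∈   = ∨-true⁺ˡ (start∈ vis)
            ; prev∈    = cur∈V′
            -- If `σ cur` had been visited, it would be the start k, excluded by q, or its
            -- predecessor `cur` would already lie in V.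
            ; next∉    = ¬-not λ e → [ (λ r → ==F-false⇒≢ q r) , (λ r → true≢false (≡.trans (≡.sym r) (next∉ vis))) ]′ (V′-backward cur e)
            ; ⊆class   = rep-cur })
            (ℕₚ.≤-trans fuel (ℕₚ.≤-trans (ℕₚ.≤-reflexive (ℕₚ.+-suc _ f)) (ℕₚ.+-monoˡ-≤ f grows)))

      cyclePhase-first : ∀ {σ τ} → Orients E σ τ → ∀ {k} → rep E k ≡ k → degE E k ≡ 2 →
                         findF (adjE E k) ≡ just (σ k) → pow (cyclePhase M E k) ≈ classVal σ k
      cyclePhase-first {σ} {τ} o {k} rk d found rewrite found = begin
        pow ((phase (kind M k (σ k)) ℕ.+ walkPhase M E n k k (σ k)) ℕ.% 4)
          ≈⟨ pow-% (phase (kind M k (σ k)) ℕ.+ walkPhase M E n k k (σ k)) ⟩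
        pow (phase (kind M k (σ k)) ℕ.+ walkPhase M E n k k (σ k))
          ≈⟨ pow-+ (phase (kind M k (σ k))) _ ⟩
        pow (phase (kind M k (σ k))) * pow (walkPhase M E n k k (σ k))
          ≈⟨ *-cong (pow-phase _ (edges (edge o k)))
               (walkPhase-val o rk d n k (_==F k) (record
                 { backward = λ v e → inj₁ (==F⇒≡ e)
                 ; forward  = λ v e → inj₂ (==F⇒≡ e)
                 ; start∈   = ≡⇒==F {i = k} refl
                 ; prev∈    = ≡⇒==F {i = k} refl
                 ; next∉    = ≢⇒==F λ q → isEdge⇒irreflexive M E edges (edge o k) (≡.sym q)
                 ; ⊆class   = rk }) (ℕₚ.m≤n+m n _)) ⟩
        h k (σ k) * prodF (λ v → ((rep E v ==F k) ∧ not (v ==F k)) ▹ h v (σ v))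
          ≈⟨ prodF-remove (λ v → rep E v ==F k) (λ v → h v (σ v)) k (≡⇒==F rk) ⟨
        classVal σ k ∎

      cyclePhase<4 : ∀ k → cyclePhase M E k ℕ.< 4
      cyclePhase<4 k with findF (adjE E k)
      ... | nothing = s≤s z≤n
      ... | just j  = m%n<n (phase (kind M k j) ℕ.+ walkPhase M E n k k j) 4

      -- The phase is measured in the direction of the first neighbour that `findF` meets, which may
      -- be σ or τ. The sum is symmetric in the two, so both cases reduce to `trace-unique`.
      classVal-trace : ∀ {σ τ} → Orients E σ τ → ∀ {k} → rep E k ≡ k → degE E k ≡ 2 →
                       classVal σ k + classVal τ k ≈ trace (cyclePhase M E k)
      classVal-trace {σ} {τ} o {k} rk d with j , q ← findF-found {p = adjE E k} (σ k) (edge o k)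
        with cover o (proj₁ (findF-just {p = adjE E k} q))
      ... | inj₁ refl = trace-unique (cyclePhase<4 k) (cyclePhase-first o rk d q) (classVal-inverse o k)
      ... | inj₂ refl = trans (+-comm _ _)
        (trace-unique (cyclePhase<4 k) (cyclePhase-first (Orients-sym s o) rk d q) (classVal-inverse (Orients-sym s o) k))

-- Summation over supports and reversals

module Expansion {c ℓ : Level} (R : CommutativeRing c ℓ) where
  open CommutativeRing R hiding (refl; zero)
  open RingDefs R
  open RingProperties ring
  open SemiringSolver commutativeSemiring using (solve; _:+_; _:*_; _:=_)
  open Determinant R
  open CycleValues R
  open SetoidReasoning setoid

  sgn-+ : ∀ a b → sgn (a ℕ.+ b) ≈ sgn a * sgn b
  sgn-+ zero    b = sym (*-identityˡ _)
  sgn-+ (suc a) b = trans (-‿cong (sgn-+ a b)) (-‿distribˡ-* _ _)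

  sgn² : ∀ a → sgn a * sgn a ≈ 1#
  sgn² zero    = *-identityˡ 1#
  sgn² (suc a) = trans (-x*-y≈x*y (sgn a) (sgn a)) (sgn² a)

  -- Mediates between n - c in the weight and n + c in `det-permMatrix`, which have the same parity.
  sgn-∸ : ∀ {a b} → b ℕ.≤ a → sgn (a ℕ.∸ b) ≈ sgn (a ℕ.+ b)
  sgn-∸ {a} {b} b≤a = begin
    sgn (a ℕ.∸ b)                      ≈⟨ *-identityʳ _ ⟨
    sgn (a ℕ.∸ b) * 1#                 ≈⟨ *-congˡ (sgn² b) ⟨
    sgn (a ℕ.∸ b) * (sgn b * sgn b)    ≈⟨ *-assoc _ _ _ ⟨
    (sgn (a ℕ.∸ b) * sgn b) * sgn b    ≈⟨ *-congʳ (sgn-+ (a ℕ.∸ b) b) ⟨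
    sgn (a ℕ.∸ b ℕ.+ b) * sgn b        ≡⟨ cong (λ m → sgn m * sgn b) (ℕₚ.m∸n+n≡m b≤a) ⟩
    sgn a * sgn b                      ≈⟨ sgn-+ a b ⟨
    sgn (a ℕ.+ b)                      ∎

  fromℕ-+ : ∀ a b → fromℕ (a ℕ.+ b) ≈ fromℕ a + fromℕ b
  fromℕ-+ zero    b = sym (+-identityˡ _)
  fromℕ-+ (suc a) b = trans (+-congˡ (fromℕ-+ a b)) (sym (+-assoc _ _ _))

  fromℕ-double : ∀ m → fromℕ (2 ℕ.* m) ≈ (1# + 1#) * fromℕ m
  fromℕ-double m = begin
    fromℕ (m ℕ.+ (m ℕ.+ 0))    ≈⟨ fromℕ-+ m _ ⟩
    fromℕ m + fromℕ (m ℕ.+ 0)  ≡⟨ cong (λ k → fromℕ m + fromℕ k) (ℕₚ.+-identityʳ m) ⟩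
    fromℕ m + fromℕ m          ≈⟨ +-cong (*-identityˡ _) (*-identityˡ _) ⟨
    1# * fromℕ m + 1# * fromℕ m ≈⟨ distribʳ _ 1# 1# ⟨
    (1# + 1#) * fromℕ m        ∎

  module _ (ι : Carrier) (ι² : ι * ι ≈ - 1#) where

    prodF-trace : ∀ {n} (cyc : Fin n → Bool) (p : Fin n → ℕ) →
                  prodF (λ k → cyc k ▹ trace ι ι² (p k)) ≈
                  allF (λ k → not (cyc k) ∨ ((p k ℕ.≡ᵇ 0) ∨ (p k ℕ.≡ᵇ 2))) ▸
                    (sgn (countF (λ k → cyc k ∧ (p k ℕ.≡ᵇ 2))) * fromℕ (2 ℕ.^ countF cyc))
    prodF-trace {zero}  cyc p = sym (trans (*-identityˡ _) (+-identityʳ 1#))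
    prodF-trace {suc n} cyc p = trans (*-congˡ (prodF-trace (cyc ∘ suc) (p ∘ suc))) (step (cyc zero) (p zero ℕ.≡ᵇ 0) (p zero ℕ.≡ᵇ 2))
      where
      l = countF (λ k → cyc (suc k) ∧ (p (suc k) ℕ.≡ᵇ 2))
      s = countF (cyc ∘ suc)
      any = anyF (λ k → not (not (cyc (suc k)) ∨ ((p (suc k) ℕ.≡ᵇ 0) ∨ (p (suc k) ℕ.≡ᵇ 2))))
      -- The Booleans c, z and t abstract the tests at vertex 0: cycle representative, phase 0,
      -- phase 2.
      step : ∀ c z t → (c ▹ ((z ∨ t) ▸ (sgn (if t then 1 else 0) * (1# + 1#)))) * (not any ▸ (sgn l * fromℕ (2 ℕ.^ s))) ≈
             not (not (not c ∨ (z ∨ t)) ∨ any) ▸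
               (sgn ((if c ∧ t then 1 else 0) ℕ.+ l) * fromℕ (2 ℕ.^ ((if c then 1 else 0) ℕ.+ s)))
      real : ∀ t → (sgn (if t then 1 else 0) * (1# + 1#)) * (not any ▸ (sgn l * fromℕ (2 ℕ.^ s))) ≈
             not any ▸ (sgn ((if t then 1 else 0) ℕ.+ l) * fromℕ (2 ℕ.* 2 ℕ.^ s))
      real t = trans (▸-*ʳ (not any) _ _) (▸-cong (not any) λ _ → sym (begin
        sgn (d ℕ.+ l) * fromℕ (2 ℕ.* 2 ℕ.^ s)                   ≈⟨ *-cong (sgn-+ d l) (fromℕ-double (2 ℕ.^ s)) ⟩
        (sgn d * sgn l) * ((1# + 1#) * fromℕ (2 ℕ.^ s))         ≈⟨ solve 4 (λ a b x y → (a :* b) :* (x :* y) := (a :* x) :* (b :* y)) ≈-refl (sgn d) (sgn l) (1# + 1#) (fromℕ (2 ℕ.^ s)) ⟩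
        (sgn d * (1# + 1#)) * (sgn l * fromℕ (2 ℕ.^ s))         ∎))
        where d = if t then 1 else 0
      step false z     t     = *-identityˡ _
      step true  false false = zeroˡ _
      step true  false true  = real true
      step true  true  t     = real t

    module _ {n} (M : MixedGraph n) (u w : Fin n → Carrier)
             (w² : ∀ k → deg M k ≢ 0 → w k * w k ≈ u k) where

      term : (Fin n → Fin n) → Carrier
      term σ = det (permMatrix id σ) * prodF (λ v → RH M ι w v (σ v))

      term-cong : ∀ {σ σ′} → σ ≗ σ′ → term σ ≈ term σ′
      term-cong e = *-cong (det-cong λ r s → reflexive (cong (λ x → (x ==F s) ▸ 1#) (e r)))
                           (prodF-cong λ v → reflexive (cong (RH M ι w v) (e v)))

      weight : ESet n → Carrier
      weight E = sgn ((n ℕ.∸ cComp E) ℕ.+ lNeg M E) * (fromℕ (2 ℕ.^ sCyc E) * prodF u)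

      -- Recognises permutations, and its failure is directly useful: a missed value is a zero
      -- column of the coefficient matrix.
      isSurjective : (Fin n → Fin n) → Bool
      isSurjective σ = allF λ l → anyF λ r → σ r ==F l

      surjective⇒Inverses : ∀ σ → isSurjective σ ≡ true → ∃ (Inverses σ)
      surjective⇒Inverses σ e = (λ l → proj₁ (pre l)) , rightInverse⇒Inverses λ l → ==F⇒≡ (proj₂ (pre l))
        where
        pre : ∀ l → ∃ λ r → (σ r ==F l) ≡ true
        pre l = anyF⁻ (allF⁻ e l)

      Inverses⇒surjective : ∀ {σ τ} → Inverses σ τ → isSurjective σ ≡ true
      Inverses⇒surjective {τ = τ} i = allF⁺ λ l → anyF⁺ (τ l) (≡⇒==F (στ i l))

      nonsurjective-term : ∀ σ → isSurjective σ ≡ false → term σ ≈ 0#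
      nonsurjective-term σ e with l , q ← allF-false⁻ e = trans (*-congʳ (zero-column (permMatrix id σ) l λ r →
        ▸-zero {σ r ==F l} 1# λ p → contradiction (≡.trans (≡.sym (anyF⁺ r p)) q) true≢false)) (zeroˡ _)

      supportedOn : ESet n → (Fin n → Fin n) → Bool
      supportedOn E σ = ⌊ Vecₚ.≡-dec (Vecₚ.≡-dec Data.Bool._≟_) E (support σ) ⌋

      support-elementary : ∀ {σ τ} → Inverses σ τ → (∀ v → isEdge (kind M v (σ v)) ≡ true) →
                           isSubgraph M (support σ) ∧ isElementary (support σ) ≡ true
      support-elementary {σ} i e = ∧-true⁺ (isSubgraph⁺ M (support σ) edges (support-symmetric σ))
        (Regular⇒isElementary (support σ) (Orients⇒Regular (support-symmetric σ) (inverses⇒Orients i)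
          (isEdge⇒irreflexive M (support σ) edges)))
        where
        edges : ∀ {k l} → Edge (support σ) k l → isEdge (kind M k l) ≡ true
        edges {k} {l} a with support-edge⁻ σ a
        ... | inj₁ refl = e k
        ... | inj₂ refl = ≡.trans (cong isEdge (skew M l (σ l))) (flip-edge (kind M l (σ l)) (e l))
          where
          flip-edge : ∀ κ → isEdge κ ≡ true → isEdge (flipK κ) ≡ true
          flip-edge undir _ = refl
          flip-edge out   _ = refl
          flip-edge inn   _ = refl

      -- A map that is no permutation has coefficient 0, and a step along a non-edge has entry 0. In
      -- the remaining case `support σ` is an elementary subgraph, against the assumption on E.
      nonelementary-term : ∀ E σ → isSubgraph M E ∧ isElementary E ≡ false → supportedOn E σ ▸ term σ ≈ 0#
      nonelementary-term E σ e = ▸-zero {supportedOn E σ} (term σ) λ q → go (⌊⌋-true⁻ q) (bool-split (isSurjective σ))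
        where
        go : E ≡ support σ → isSurjective σ ≡ true ⊎ isSurjective σ ≡ false → term σ ≈ 0#
        go refl (inj₂ q) = nonsurjective-term σ q
        go refl (inj₁ q) with bool-split (allF λ v → isEdge (kind M v (σ v)))
        ... | inj₁ all = contradiction (≡.trans (≡.sym
          (support-elementary (proj₂ (surjective⇒Inverses σ q)) (allF⁻ all))) e) true≢false
        ... | inj₂ ¬all with v , ¬e ← allF-false⁻ ¬all = trans (*-congˡ (prodF-zero v
          (trans (*-congʳ (reflexive (cong (kindVal ι) (noEdge (kind M v (σ v)) ¬e)))) (zeroˡ _)))) (zeroʳ _)
          where
          noEdge : ∀ κ → isEdge κ ≡ false → κ ≡ none
          noEdge none _ = refl

      module _ {E : ESet n} (edges : ∀ {k l} → Edge E k l → isEdge (kind M k l) ≡ true)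
               (s : Symmetric E) {σ τ} (o : Orients E σ τ) where

        private
          -- Only a bit at a cycle representative changes the permutation: reversing a single edge
          -- does nothing, and bits at non-representatives are not read. Fixing all these at `true`
          -- makes the bit vector unique.
          admissible : Vec Bool n → Bool
          admissible b = allF λ k → lookup b k ∨ isCycleRep E k

          flipped : Vec Bool n → Fin n → Fin n
          flipped b = reorient E σ τ (lookup b)

          φ : Vec Bool n → Vec (Fin n) n
          φ b = tabulate (flipped b)

          ψ : Vec (Fin n) n → Vec Bool n
          ψ σ′ = tabulate λ k → not (isCycleRep E k) ∨ (lookup σ′ k ==F σ k)

          fibre : Vec (Fin n) n → Bool
          fibre σ′ = supportedOn E (lookup σ′) ∧ isSurjective (lookup σ′)

          φ-fibre : ∀ b → admissible b ≡ true → fibre (φ b) ≡ true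
          φ-fibre b _ = ∧-true⁺
            (⌊⌋-true⁺ (≡.trans (≡.sym (Orients⇒support s o′)) (support-cong λ v → ≡.sym (Vecₚ.lookup∘tabulate (flipped b) v))))
            (Inverses⇒surjective (rightInverse⇒Inverses λ k →
              ≡.trans (Vecₚ.lookup∘tabulate (flipped b) _) (στ (inverse o′) k)))
            where o′ = reorient-orients s o (lookup b)

          fibre-orients : ∀ σ′ → fibre σ′ ≡ true → ∃ (Orients E (lookup σ′))
          fibre-orients σ′ e with q , r ← ∧-true⁻ {supportedOn E (lookup σ′)} e =
            let τ′ , i = surjective⇒Inverses (lookup σ′) r in
            τ′ , subst (λ F → Orients F (lookup σ′) τ′) (≡.sym (⌊⌋-true⁻ q)) (inverses⇒Orients i)

          ψ-ok : ∀ σ′ → fibre σ′ ≡ true → admissible (ψ σ′) ≡ true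
          ψ-ok σ′ _ = allF⁺ λ k → ≡.trans (cong (_∨ isCycleRep E k) (Vecₚ.lookup∘tabulate _ k)) (lem (isCycleRep E k) _)
            where
            lem : ∀ c x → (not c ∨ x) ∨ c ≡ true
            lem false x     = refl
            lem true  false = refl
            lem true  true  = refl

          φψ : ∀ σ′ → fibre σ′ ≡ true → φ (ψ σ′) ≡ σ′
          φψ σ′ e = ≡.trans (Vecₚ.tabulate-cong same) (Vecₚ.tabulate∘lookup σ′)
            where
            o′ = proj₂ (fibre-orients σ′ e)
            same : ∀ v → flipped (ψ σ′) v ≡ lookup σ′ v
            same v rewrite Vecₚ.lookup∘tabulate (λ k → not (isCycleRep E k) ∨ (lookup σ′ k ==F σ k)) (rep E v)
              with bool-split (isCycleRep E (rep E v))
            ... | inj₁ q rewrite q = ≡.sym (reorientation s o o′ v)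
            ... | inj₂ q rewrite q = ≡.sym (either (cover o (edge o′ v)))
              where
              -- Two distinct neighbours would give degree 2 throughout the component and make its
              -- representative a cycle representative. So this is a single edge, where both
              -- directions coincide.
              σ≡τ : σ v ≡ τ v
              σ≡τ with σ v Fin.≟ τ v
              ... | yes r = r
              ... | no ¬r = contradiction (≡.trans (≡.sym (isCycleRep⁺ E (rep-idem E s v)
                (≡.trans (invariant⇒rep s o (degE E) (≡.sym ∘ degE-σ s o) v) (degE-two s o ¬r)))) q) true≢false
              either : lookup σ′ v ≡ σ v ⊎ lookup σ′ v ≡ τ v → lookup σ′ v ≡ σ v
              either = [ id , (λ r → ≡.trans r (≡.sym σ≡τ)) ]′

          ψφ : ∀ b → admissible b ≡ true → ψ (φ b) ≡ b
          ψφ b e = ≡.trans (Vecₚ.tabulate-cong same) (Vecₚ.tabulate∘lookup b)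
            where
            same : ∀ k → not (isCycleRep E k) ∨ (lookup (φ b) k ==F σ k) ≡ lookup b k
            same k rewrite Vecₚ.lookup∘tabulate (flipped b) k with bool-split (isCycleRep E k)
            ... | inj₂ q rewrite q = ≡.sym ([ id , (λ r → contradiction (≡.trans (≡.sym r) q) true≢false) ]′
                                       (∨-true⁻ {lookup b k} (allF⁻ e k)))
            ... | inj₁ q with rk , d ← isCycleRep⁻ E q rewrite q | rk with lookup b k
            ...   | true  = ≡⇒==F {i = σ k} refl
            ...   | false = ≢⇒==F λ r → degE≡2⇒ s o d (≡.sym r)

          val : (Fin n → Fin n) → Fin n → Carrier
          val = classVal ι ι² M {E} edges s

          -- An inadmissible bit receives the value 0, so the sum may run over all bit vectors and
          -- then factors over the vertices.
          choice : Fin n → Bool → Carrier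
          choice k true  = val σ k
          choice k false = isCycleRep E k ▸ val τ k

          h′ : Fin n → Fin n → Carrier
          h′ = h ι ι² M {E} edges s

          -- Each factor is written as a product over k that is trivial except at k = `rep E v`;
          -- exchanging the products groups the factors by component, where the bit is constant.
          prodF-classes : ∀ b → prodF (λ v → h′ v (flipped b v)) ≈
            prodF (λ k → if lookup b k then val σ k else val τ k)
          prodF-classes b = begin
            prodF (λ v → h′ v (flipped b v))
              ≈⟨ prodF-cong (λ v → trans (prodF-single {f = λ k → (rep E v ==F k) ▹ h′ v (flipped b v)} (rep E v)
                   λ k k≢ → reflexive (cong (_▹ h′ v (flipped b v)) (≢⇒==F (k≢ ∘ ≡.sym))))
                   (reflexive (cong (_▹ h′ v (flipped b v)) (≡⇒==F {i = rep E v} refl)))) ⟨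
            prodF (λ v → prodF (λ k → (rep E v ==F k) ▹ h′ v (flipped b v)))
              ≈⟨ prodF-swap (λ v k → (rep E v ==F k) ▹ h′ v (flipped b v)) ⟩
            prodF (λ k → prodF (λ v → (rep E v ==F k) ▹ h′ v (flipped b v)))
              ≈⟨ prodF-cong by-class ⟩
            prodF (λ k → if lookup b k then val σ k else val τ k) ∎
            where
            by-class : ∀ k → prodF (λ v → (rep E v ==F k) ▹ h′ v (flipped b v)) ≈
              (if lookup b k then val σ k else val τ k)
            by-class k with lookup b k in q
            ... | true  = prodF-cong λ v → ▹-cong (rep E v ==F k) λ r →
              reflexive (cong (h′ v) (if-cong (≡.trans (cong (lookup b) (==F⇒≡ r)) q)))
            ... | false = prodF-cong λ v → ▹-cong (rep E v ==F k) λ r →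
              reflexive (cong (h′ v) (if-cong (≡.trans (cong (lookup b) (==F⇒≡ r)) q)))

          -- A spanning orientation gives every vertex an edge, so the hypothesis on w is available
          -- at each of them.
          deg≢0 : ∀ k → deg M k ≢ 0
          deg≢0 k d = true≢false (≡.trans (≡.sym (edges (edge o k))) (countF≡0⇒none d (σ k)))

          prodF-RH : ∀ {σ′ τ′} → Inverses σ′ τ′ →
                     prodF (λ v → RH M ι w v (σ′ v)) ≈ prodF (λ v → h′ v (σ′ v)) * prodF u
          prodF-RH {σ′} i = begin
            prodF (λ v → h′ v (σ′ v) * (w v * w (σ′ v)))
              ≈⟨ prodF-* (λ v → h′ v (σ′ v)) (λ v → w v * w (σ′ v)) ⟩
            prodF (λ v → h′ v (σ′ v)) * prodF (λ v → w v * w (σ′ v))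
              ≈⟨ *-congˡ (trans (prodF-* w (w ∘ σ′)) (*-congˡ (prodF-permute i w))) ⟩
            prodF (λ v → h′ v (σ′ v)) * (prodF w * prodF w)
              ≈⟨ *-congˡ (trans (sym (prodF-* w w)) (prodF-cong λ k → w² k (deg≢0 k))) ⟩
            prodF (λ v → h′ v (σ′ v)) * prodF u ∎

          scale : Carrier
          scale = sgn (n ℕ.+ cComp E) * prodF u

          term-flipped : ∀ b → term (flipped b) ≈ scale *
            prodF (λ k → if lookup b k then val σ k else val τ k)
          term-flipped b = begin
            det (permMatrix id (flipped b)) * prodF (λ v → RH M ι w v (flipped b v))
              ≈⟨ *-cong (det-permMatrix (inverse o′) classes) (prodF-RH (inverse o′)) ⟩
            sgn (n ℕ.+ countF (λ k → rep E k ==F k)) * (prodF (λ v → h′ v (flipped b v)) * prodF u)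
              ≈⟨ *-cong (reflexive (cong (λ m → sgn (n ℕ.+ m)) (countF-cong λ k → ≡.sym (isRep≡ E k))))
                        (trans (*-congʳ (prodF-classes b)) (*-comm _ _)) ⟩
            sgn (n ℕ.+ cComp E) * (prodF u * _)
              ≈⟨ *-assoc _ _ _ ⟨
            scale * _ ∎
            where
            o′ = reorient-orients s o (lookup b)
            classes : Classes (flipped b) (rep E)
            classes = record { r-σ = rep-σ s o′ ; r-idem = rep-idem E s ; connected = invariant⇒rep s o′ }

          term-choice : ∀ b → admissible b ▸ term (lookup (φ b)) ≈ scale * prodF (λ k → choice k (lookup b k))
          term-choice b with admissible b in q
          ... | true = trans (term-cong (Vecₚ.lookup∘tabulate (flipped b)))
            (trans (term-flipped b) (*-congˡ (prodF-cong λ k → pick k (lookup b k) (allF⁻ q k))))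
            where
            pick : ∀ k d → d ∨ isCycleRep E k ≡ true →
              (if d then val σ k else val τ k) ≈ choice k d
            pick k true  e = ≈-refl
            pick k false e rewrite e = ≈-refl
          ... | false with k , r ← allF-false⁻ q = sym (trans (*-congˡ (prodF-zero k (none-chosen (lookup b k) r))) (zeroʳ _))
            where
            none-chosen : ∀ d → d ∨ isCycleRep E k ≡ false → choice k d ≈ 0#
            none-chosen false e rewrite e = ≈-refl

          -- At a cycle representative the two bits give both directions. Elsewhere only `true`
          -- counts and contributes 1: the class of k is empty, or it is a single edge whose two
          -- factors are inverse to each other.
          choice-sum : ∀ k → S (false ∷ true ∷ []) (choice k) ≈ isCycleRep E k ▹ trace ι ι² (cyclePhase M E k)
          choice-sum k with bool-split (isCycleRep E k)
          ... | inj₁ q with rk , d ← isCycleRep⁻ E q rewrite q =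
            trans (+-congˡ (+-identityʳ _)) (trans (+-comm _ _) (classVal-trace ι ι² M {E} edges s o rk d))
          ... | inj₂ q rewrite q = trans (+-identityˡ _) (trans (+-identityʳ _) (trivial-class (rep E k Fin.≟ k)))
            where
            trivial-class : Dec (rep E k ≡ k) → val σ k ≈ 1#
            trivial-class (no rk≢k) = prodF-one λ v → ▹-one {rep E v ==F k} λ e →
              contradiction (≡.trans (cong (rep E) (≡.sym (==F⇒≡ e))) (≡.trans (rep-idem E s v) (==F⇒≡ e))) rk≢k
            trivial-class (yes rk) with deg∈ (Orients⇒Regular s o (isEdge⇒irreflexive M E edges)) k
            ... | inj₁ d = classVal-edge ι ι² M {E} edges s o rk d
            ... | inj₂ d = contradiction (≡.trans (≡.sym (isCycleRep⁺ E rk d)) q) true≢false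

        -- Admissible bit vectors parametrise the permutations with support E relative to the fixed
        -- orientation σ, so the sum becomes a product of one two-term sum per vertex.
        fibre-sum : S (allVecOf (allFin n) n) (λ σ′ → supportedOn E (lookup σ′) ▸ term (lookup σ′)) ≈
                    allF (λ k → not (isCycleRep E k) ∨ isRealCycle M E k) ▸ weight E
        fibre-sum = begin
          S Fs (λ σ′ → supportedOn E (lookup σ′) ▸ term (lookup σ′))
            ≈⟨ S-cong Fs restrict ⟩
          S Fs (λ σ′ → fibre σ′ ▸ term (lookup σ′))
            ≈⟨ reindex {as = Fs} {allBoolVec n} (allVecOf-enumerates {xs = allFin n} (allFin-enumerates n) n) (allBoolVec-enumerates n)
                 (Vecₚ.≡-dec Fin._≟_) (Vecₚ.≡-dec Data.Bool._≟_) fibre admissible φ ψ φ-fibre ψ-ok φψ ψφ (λ σ′ → term (lookup σ′)) ⟩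
          S (allBoolVec n) (λ b → admissible b ▸ term (lookup (φ b)))
            ≈⟨ S-cong (allBoolVec n) term-choice ⟩
          S (allBoolVec n) (λ b → scale * prodF (λ k → choice k (lookup b k)))
            ≈⟨ S-*ˡ (allBoolVec n) scale _ ⟨
          scale * S (allBoolVec n) (λ b → prodF (λ k → choice k (lookup b k)))
            ≡⟨ cong (λ bs → scale * S bs (λ b → prodF (λ k → choice k (lookup b k)))) (allBoolVec≡ n) ⟩
          scale * S (allVecOf (false ∷ true ∷ []) n) (λ b → prodF (λ k → choice k (lookup b k)))
            ≈⟨ *-congˡ (trans (prodF-sum (false ∷ true ∷ []) choice) (prodF-cong choice-sum)) ⟩
          scale * prodF (λ k → isCycleRep E k ▹ trace ι ι² (cyclePhase M E k))
            ≈⟨ *-congˡ (prodF-trace (isCycleRep E) (cyclePhase M E)) ⟩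
          scale * (ok ▸ (sgn (lNeg M E) * fromℕ (2 ℕ.^ sCyc E)))
            ≈⟨ ▸-*ʳ ok scale _ ⟩
          ok ▸ (scale * (sgn (lNeg M E) * fromℕ (2 ℕ.^ sCyc E)))
            ≈⟨ ▸-cong ok (λ _ → weigh) ⟩
          ok ▸ weight E ∎
          where
          Fs = allVecOf (allFin n) n
          ok = allF (λ k → not (isCycleRep E k) ∨ isRealCycle M E k)
          restrict : ∀ σ′ → supportedOn E (lookup σ′) ▸ term (lookup σ′) ≈ fibre σ′ ▸ term (lookup σ′)
          restrict σ′ with supportedOn E (lookup σ′) | isSurjective (lookup σ′) in q
          ... | false | _     = ≈-refl
          ... | true  | true  = ≈-refl
          ... | true  | false = nonsurjective-term (lookup σ′) q
          weigh : scale * (sgn (lNeg M E) * fromℕ (2 ℕ.^ sCyc E)) ≈ weight E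
          weigh = begin
            (sgn (n ℕ.+ cComp E) * prodF u) * (sgn (lNeg M E) * fromℕ (2 ℕ.^ sCyc E))
              ≈⟨ solve 4 (λ a p l t → (a :* p) :* (l :* t) := (a :* l) :* (t :* p)) ≈-refl _ _ _ _ ⟩
            (sgn (n ℕ.+ cComp E) * sgn (lNeg M E)) * (fromℕ (2 ℕ.^ sCyc E) * prodF u)
              ≈⟨ *-congʳ (*-congʳ (sgn-∸ (countF≤n (isRep E)))) ⟨
            (sgn (n ℕ.∸ cComp E) * sgn (lNeg M E)) * (fromℕ (2 ℕ.^ sCyc E) * prodF u)
              ≈⟨ *-congʳ (sgn-+ (n ℕ.∸ cComp E) (lNeg M E)) ⟨
            weight E ∎

      -- The first two conditions of `isRSES` decide whether E can carry a nonzero term at all. The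
      -- condition on real cycles is not tested beforehand but emerges from the traces in
      -- `fibre-sum`.
      support-sum : ∀ E → S (allVecOf (allFin n) n) (λ σ → supportedOn E (lookup σ) ▸ term (lookup σ)) ≈
                          isRSES M E ▸ weight E
      support-sum E with isSubgraph M E in p | isElementary E in q
      ... | false | _     = S-zero (allVecOf (allFin n) n) λ σ → nonelementary-term E (lookup σ) (cong (_∧ isElementary E) p)
      ... | true  | false = S-zero (allVecOf (allFin n) n) λ σ → nonelementary-term E (lookup σ) (cong₂ _∧_ p q)
      ... | true  | true  =
        let edges , s = isSubgraph⁻ M E p
            _ , _ , o = orientation E (isElementary⇒Regular E s (isEdge⇒irreflexive M E edges) q)
        in fibre-sum {E} edges s o

      expansion : det (RH M ι w) ≈ sumL (map weight (RSESs M))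
      expansion = begin
        det (RH M ι w)
          ≈⟨ leibniz (RH M ι w) id ⟩
        S Fs (λ σ → term (lookup σ))
          -- Each term is attached to the single E that equals its support, after which the two sums
          -- can be exchanged.
          ≈⟨ S-cong Fs (λ σ → allESet-enumerates n (λ E → supportedOn E (lookup σ)) (support (lookup σ)) (λ _ → term (lookup σ))
               (⌊⌋-true⁺ refl) (λ E → ⌊⌋-true⁻)) ⟨
        S Fs (λ σ → S (allESet n) (λ E → supportedOn E (lookup σ) ▸ term (lookup σ)))
          ≈⟨ S-swap Fs (allESet n) _ ⟩
        S (allESet n) (λ E → S Fs (λ σ → supportedOn E (lookup σ) ▸ term (lookup σ)))
          ≈⟨ S-cong (allESet n) support-sum ⟩
        S (allESet n) (λ E → isRSES M E ▸ weight E)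
          ≈⟨ S-filter (isRSES M) (allESet n) weight ⟨
        sumL (map weight (RSESs M)) ∎
        where Fs = allVecOf (allFin n) n

theorem2p1 : ∀ {c ℓ : Level} (R : CommutativeRing c ℓ) →
    let open CommutativeRing R
        open RingDefs R
    in (n : ℕ) (M : MixedGraph n)
       (ι : Carrier) → ι * ι ≈ - 1# →
       (u w : Fin n → Carrier) →
       (∀ k → deg M k ≢ 0 → u k * fromℕ (deg M k) ≈ 1#) →
       (∀ k → deg M k ≢ 0 → w k * w k ≈ u k) →
       det (RH M ι w) ≈
         sumL (map (λ E → sgn ((n ℕ.∸ cComp E) ℕ.+ lNeg M E)
                          * (fromℕ (2 ℕ.^ sCyc E) * prodF u))
                   (RSESs M))
theorem2p1 R n M ι ι² u w _ w² = Expansion.expansion R ι ι² M u w w²
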